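{- For every $k\geq3$, $$H_{21\mbox{ - }3\mbox{ - }\cdots\mbox{ - }k}(x)=\frac{x}{U_k^2\left(\frac{1}{2\sqrt{x}}\right)}\left(\sum_{j=1}^{k-2}U_j^2\left(\frac{1}{2\sqrt{x}}\right)-1\right).$$
   Context: A generalized pattern is a permutation of $\{1,\dots,k\}$ written as a word $\tau_1\cdots\tau_k$ in which each pair of adjacent letters may or may not be separated by a dash "-". An occurrence of $\tau$ in $\pi=\pi_1\cdots\pi_n\in S_n$ is a choice of indices $i_1<\dots<i_k$ with $(\pi_{i_1},\dots,\pi_{i_k})$ order-isomorphic to $(\tau_1,\dots,\tau_k)$ and $i_{j+1}=i_j+1$ whenever $\tau_j,\tau_{j+1}$ are not separated by a dash; $\pi$ avoids $\tau$ if there is no occurrence. $1\mbox{ - }3\mbox{ - }2$ is the classical pattern $132$. $H_\tau(x)=\sum_{n\geq0}h_\tau(n)x^n$ where $h_\tau(n)$ is the number of permutations in $S_n$ avoiding $\tau$ and containing exactly one occurrence of $1\mbox{ - }3\mbox{ - }2$. $U_p$ is the Chebyshev polynomial of the second kind, $U_p(\cos\theta)=\sin((p+1)\theta)/\sin\theta$. -}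

module Defs where

open import Data.Nat using (ℕ; zero; suc; _+_; _∸_; _≡ᵇ_; _<ᵇ_)
open import Data.Bool using (Bool; true; false; not; _∧_; _∨_; if_then_else_)
open import Data.List using (List; []; _∷_; [_]; map; concatMap; upTo; length; replicate; foldr)
open import Data.Integer as ℤ using (ℤ; +_)

words : ℕ → ℕ → List (List ℕ)
words m zero    = [ [] ]
words m (suc n) = concatMap (λ a → map (a ∷_) (words m n)) (upTo m)

countB : {A : Set} → (A → Bool) → List A → ℕ
countB p []       = 0
countB p (x ∷ xs) = if p x then suc (countB p xs) else countB p xs

filterB : {A : Set} → (A → Bool) → List A → List A
filterB p []       = []
filterB p (x ∷ xs) = if p x then x ∷ filterB p xs else filterB p xs

anyB allB : {A : Set} → (A → Bool) → List A → Bool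
anyB p []       = false
anyB p (x ∷ xs) = p x ∨ anyB p xs
allB p []       = true
allB p (x ∷ xs) = p x ∧ allB p xs

distinct : List ℕ → Bool
distinct []      = true
distinct (a ∷ w) = not (anyB (a ≡ᵇ_) w) ∧ distinct w

-- S_n: the permutations of {0,…,n-1} in one-line notation π₁⋯πₙ
-- (values shifted by -1, irrelevant for pattern containment)
perms : ℕ → List (List ℕ)
perms n = filterB distinct (words n n)

nth : List ℕ → ℕ → ℕ
nth []      _       = 0
nth (x ∷ _) zero    = x
nth (_ ∷ w) (suc i) = nth w i

strictlyIncreasing : List ℕ → Bool
strictlyIncreasing (i ∷ j ∷ w) = (i <ᵇ j) ∧ strictlyIncreasing (j ∷ w)
strictlyIncreasing _           = true

indexTuples : ℕ → ℕ → List (List ℕ)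
indexTuples k n = filterB strictlyIncreasing (words n k)

record GPattern : Set where
  field
    letters  : List ℕ      -- τ₁ ⋯ τ_k (a permutation of {1,…,k})
    adjacent : List Bool   -- entry j (j = 1..k-1): true iff τ_j τ_{j+1} NOT separated by a dash
open GPattern public

checkAdj : List Bool → List ℕ → Bool
checkAdj (b ∷ bs) (i ∷ j ∷ is) = (not b ∨ (j ≡ᵇ suc i)) ∧ checkAdj bs (j ∷ is)
checkAdj _        _            = true

_==ᵇ_ : Bool → Bool → Bool
true  ==ᵇ b = b
false ==ᵇ b = not b

orderIso : List ℕ → List ℕ → List ℕ → Bool
orderIso τ π is =
  allB (λ a → allB (λ b → (nth τ a <ᵇ nth τ b) ==ᵇ (nth π (nth is a) <ᵇ nth π (nth is b)))
                 (upTo (length τ)))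
      (upTo (length τ))

isOccurrence : GPattern → List ℕ → List ℕ → Bool
isOccurrence τ π is = checkAdj (adjacent τ) is ∧ orderIso (letters τ) π is

occurrences : GPattern → List ℕ → ℕ
occurrences τ π = countB (isOccurrence τ π) (indexTuples (length (letters τ)) (length π))

avoids : GPattern → List ℕ → Bool
avoids τ π = occurrences τ π ≡ᵇ 0

p1-3-2 : GPattern
p1-3-2 = record { letters = 1 ∷ 3 ∷ 2 ∷ [] ; adjacent = false ∷ false ∷ [] }

p21-3-k : ℕ → GPattern
p21-3-k k = record
  { letters  = 2 ∷ 1 ∷ map (λ i → i + 3) (upTo (k ∸ 2))
  ; adjacent = true ∷ replicate (k ∸ 2) false }

h : GPattern → ℕ → ℕ
h τ n = countB (λ π → avoids τ π ∧ (occurrences p1-3-2 π ≡ᵇ 1)) (perms n)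

FPS : Set
FPS = ℕ → ℤ

H : GPattern → FPS
H τ n = + h τ n

one : FPS
one zero    = + 1
one (suc _) = + 0

_⊕_ : FPS → FPS → FPS
(f ⊕ g) n = f n ℤ.+ g n

⊖_ : FPS → FPS
(⊖ f) n = ℤ.- f n

_⊛_ : FPS → FPS → FPS
(f ⊛ g) n = foldr ℤ._+_ (+ 0) (map (λ i → f i ℤ.* g (n ∸ i)) (upTo (suc n)))

xpow : ℕ → FPS → FPS
xpow m f n = if n <ᵇ m then + 0 else f (n ∸ m)

-- R_j(x) = x^{j/2} U_j(1/(2√x)), a polynomial:
-- R_0 = 1, R_1 = 1, R_{j+2} = R_{j+1} - x R_j   (Chebyshev recurrence)
R : ℕ → FPS
R zero          = one
R (suc zero)    = one
R (suc (suc j)) = R (suc j) ⊕ (⊖ xpow 1 (R j))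

rhsNumerator : ℕ → FPS
rhsNumerator k =
  foldr _⊕_ (⊖ xpow (suc k) one)
        (map (λ i → xpow (k ∸ i) (R (suc i) ⊛ R (suc i))) (upTo (k ∸ 2)))

{-# OPTIONS --safe #-}
module Submission where

-- Cut a permutation containing 1-3-2 at most once at its maximum, π = u n v.  Every pair
-- x < z with x in u and z in v makes xnz an occurrence of 1-3-2, so there is at most one such pair.
-- If there is none, u lies above v; an occurrence of 21-3-⋯-k then either lies in v, or lies in u n
-- and restricts to an occurrence of 21-3-⋯-(k-1) in u.  If there is one pair, it consists of
-- adjacent values a and a+1, a stands immediately before n, and the rest of u lies above v.
-- With F_k the generating function of the permutations avoiding 1-3-2 and 21-3-⋯-k this gives
--   F_k = 1 + x F_{k-1} F_k,   H_k = x (H_{k-1} F_k + F_{k-1} H_k) + x² G_{k-1} (F_k - 1),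
-- with G_2 = 1 and G_k = F_k for k ≥ 3.  Multiplying by the polynomials R and using
-- R_k = R_{k-1} - x R_{k-2} turns these into F_k R_k = R_{k-1} and
-- H_k R_k² = x H_{k-1} R_{k-1}² + x³ R_{k-2}² (x³ R_2 R_1 for k = 3) without dividing by a power series.

-- Squaring U_j(1/(2√x)) gives x^(-j) R_j², so clearing denominators in the stated formula yields
-- the polynomial numerator; R_k has constant term 1, hence the cleared identity determines H_k. The
-- "-1" in the bracket comes from the irregular factor G_2 = 1. In the case of one pair, u ends in
-- its minimum a, and u must avoid 21-3-⋯-(k-1). As an end minimum, a can only serve as the letter 1
-- of the descent, and it does so only if no further letter has to follow, that is for k-1 = 2. Then
-- nothing may precede a, so H_3 R_3² is x³ R_2 R_1 = x³ R_1² - x⁴ instead of x³ R_1², and every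
-- later step multiplies this -x⁴ by x. The factor F_k - 1 records that v is nonempty, since it
-- contains a+1; x² accounts for a and n. The induction starts at k = 2, where F_2 = 1/(1-x) and H_2
-- = 0. The parameter `r` stands for k-2, the number of letters after the descent.

open import Defs
open import Data.Nat using (ℕ; _≤_)
open import Relation.Binary.PropositionalEquality using (_≡_)

-- Formal power series over the integers as a commutative ring

module PowerSeries where

  open import Data.Nat as ℕ using (ℕ; zero; suc; _∸_; _<_)
  import Data.Nat.Properties as ℕ
  open import Data.Integer as ℤ using (ℤ; +_)
  import Data.Integer.Properties as ℤ
  open import Data.Product using (_,_)
  open import Data.List using ([]; _∷_; map; foldr; upTo; _∷ʳ_)
  open import Data.List.Properties using (map-++; map-upTo; upTo-∷ʳ; foldr-∷ʳ; map-cong)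
  open import Data.List.Membership.Propositional using (_∈_)
  open import Data.List.Membership.Propositional.Properties using (∈-upTo⁻)
  open import Data.List.Relation.Unary.Any using (here; there)
  open import Function using (_∘_)
  open import Algebra.Bundles using (CommutativeRing)
  open import Relation.Binary.PropositionalEquality using (_≡_; refl; sym; trans; cong; cong₂; module ≡-Reasoning)
  open import Level using (0ℓ)
  open import Data.Integer.Tactic.RingSolver using (solve-∀)
  open import Algebra.Consequences.Setoid using (comm∧idˡ⇒id; comm∧distrʳ⇒distr)
  open import Relation.Binary using (Setoid)
  import Relation.Binary.Reasoning.Setoid as SetoidReasoning

  infix 4 _≐_
  _≐_ : FPS → FPS → Set
  f ≐ g = ∀ n → f n ≡ g n

  tail : FPS → FPS
  tail f n = f (suc n)

  -- Needed because the tail of a product `f ⊛ g` is `scale (f 0) (tail g)` plus `tail f ⊛ g`.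
  scale : ℤ → FPS → FPS
  scale c f n = c ℤ.* f n

  zeroS : FPS
  zeroS _ = + 0

  map-upTo-suc : {A : Set} (g : ℕ → A) (n : ℕ) → map g (upTo (suc n)) ≡ g 0 ∷ map (g ∘ suc) (upTo n)
  map-upTo-suc g n = trans (map-upTo g (suc n)) (cong (g 0 ∷_) (sym (map-upTo (g ∘ suc) n)))

  ⊛-zero : ∀ f g → (f ⊛ g) 0 ≡ f 0 ℤ.* g 0
  ⊛-zero f g = ℤ.+-identityʳ (f 0 ℤ.* g 0)

  ⊛-sucˡ : ∀ f g n → (f ⊛ g) (suc n) ≡ f 0 ℤ.* g (suc n) ℤ.+ (tail f ⊛ g) n
  ⊛-sucˡ f g n = cong (foldr ℤ._+_ (+ 0)) (map-upTo-suc (λ i → f i ℤ.* g (suc n ∸ i)) (suc n))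

  ⊛-cong : ∀ {f f′ g g′} → f ≐ f′ → g ≐ g′ → f ⊛ g ≐ f′ ⊛ g′
  ⊛-cong p q n = cong (foldr ℤ._+_ (+ 0)) (map-cong (λ i → cong₂ ℤ._*_ (p i) (q (n ∸ i))) (upTo (suc n)))

  -- The convolution unfolds from its first term only; its last term is reached by induction,
  -- peeling a first term off both sides. Together with `⊛-sucˡ` this makes commutativity an
  -- induction on the coefficient.
  ⊛-sucʳ : ∀ f g n → (f ⊛ g) (suc n) ≡ f (suc n) ℤ.* g 0 ℤ.+ (f ⊛ tail g) n
  ⊛-sucʳ f g zero
    rewrite ⊛-sucˡ f g 0 | ⊛-zero (tail f) g | ⊛-zero f (tail g) = ℤ.+-comm (f 0 ℤ.* g 1) _
  ⊛-sucʳ f g (suc n)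
    rewrite ⊛-sucˡ f g (suc n) | ⊛-sucˡ f (tail g) n | ⊛-sucʳ (tail f) g n =
      lem (f 0 ℤ.* g (suc (suc n))) (f (suc (suc n)) ℤ.* g 0) _
    where
    lem : ∀ a b c → a ℤ.+ (b ℤ.+ c) ≡ b ℤ.+ (a ℤ.+ c)
    lem = solve-∀

  ⊛-comm : ∀ f g → f ⊛ g ≐ g ⊛ f
  ⊛-comm f g zero rewrite ⊛-zero f g | ⊛-zero g f = ℤ.*-comm (f 0) (g 0)
  ⊛-comm f g (suc n) rewrite ⊛-sucˡ f g n | ⊛-sucʳ g f n =
    cong₂ ℤ._+_ (ℤ.*-comm (f 0) (g (suc n))) (⊛-comm (tail f) g n)

  ⊛-distribʳ : ∀ h f g → (f ⊕ g) ⊛ h ≐ (f ⊛ h) ⊕ (g ⊛ h)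
  ⊛-distribʳ h f g zero rewrite ⊛-zero (f ⊕ g) h | ⊛-zero f h | ⊛-zero g h = ℤ.*-distribʳ-+ (h 0) (f 0) (g 0)
  ⊛-distribʳ h f g (suc n)
    rewrite ⊛-sucˡ (f ⊕ g) h n | ⊛-sucˡ f h n | ⊛-sucˡ g h n | ⊛-distribʳ h (tail f) (tail g) n =
      lem (f 0) (g 0) (h (suc n)) _ _
    where
    lem : ∀ a b c d e → (a ℤ.+ b) ℤ.* c ℤ.+ (d ℤ.+ e) ≡ (a ℤ.* c ℤ.+ d) ℤ.+ (b ℤ.* c ℤ.+ e)
    lem = solve-∀

  scale-⊛ : ∀ c f g → scale c f ⊛ g ≐ scale c (f ⊛ g)
  scale-⊛ c f g zero rewrite ⊛-zero (scale c f) g | ⊛-zero f g = ℤ.*-assoc c (f 0) (g 0)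
  scale-⊛ c f g (suc n) rewrite ⊛-sucˡ (scale c f) g n | ⊛-sucˡ f g n | scale-⊛ c (tail f) g n =
    lem c (f 0) (g (suc n)) _
    where
    lem : ∀ c a b d → c ℤ.* a ℤ.* b ℤ.+ c ℤ.* d ≡ c ℤ.* (a ℤ.* b ℤ.+ d)
    lem = solve-∀

  ⊛-assoc : ∀ f g h → (f ⊛ g) ⊛ h ≐ f ⊛ (g ⊛ h)
  ⊛-assoc f g h zero
    rewrite ⊛-zero (f ⊛ g) h | ⊛-zero f g | ⊛-zero f (g ⊛ h) | ⊛-zero g h = ℤ.*-assoc (f 0) (g 0) (h 0)
  ⊛-assoc f g h (suc n) = begin
    ((f ⊛ g) ⊛ h) (suc n)
      ≡⟨ ⊛-sucˡ (f ⊛ g) h n ⟩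
    (f ⊛ g) 0 ℤ.* h (suc n) ℤ.+ (tail (f ⊛ g) ⊛ h) n
      ≡⟨ cong₂ ℤ._+_ (cong (ℤ._* h (suc n)) (⊛-zero f g))
           (trans (⊛-cong {g = h} (⊛-sucˡ f g) (λ _ → refl) n)
                  (⊛-distribʳ h (scale (f 0) (tail g)) (tail f ⊛ g) n)) ⟩
    f 0 ℤ.* g 0 ℤ.* h (suc n) ℤ.+ ((scale (f 0) (tail g) ⊛ h) n ℤ.+ ((tail f ⊛ g) ⊛ h) n)
      ≡⟨ cong (λ z → f 0 ℤ.* g 0 ℤ.* h (suc n) ℤ.+ z)
           (cong₂ ℤ._+_ (scale-⊛ (f 0) (tail g) h n) (⊛-assoc (tail f) g h n)) ⟩
    f 0 ℤ.* g 0 ℤ.* h (suc n) ℤ.+ (f 0 ℤ.* (tail g ⊛ h) n ℤ.+ (tail f ⊛ (g ⊛ h)) n)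
      ≡⟨ lem (f 0) (g 0) (h (suc n)) _ _ ⟩
    f 0 ℤ.* (g 0 ℤ.* h (suc n) ℤ.+ (tail g ⊛ h) n) ℤ.+ (tail f ⊛ (g ⊛ h)) n
      ≡⟨ cong (λ z → f 0 ℤ.* z ℤ.+ (tail f ⊛ (g ⊛ h)) n) (⊛-sucˡ g h n) ⟨
    f 0 ℤ.* (g ⊛ h) (suc n) ℤ.+ (tail f ⊛ (g ⊛ h)) n
      ≡⟨ ⊛-sucˡ f (g ⊛ h) n ⟨
    (f ⊛ (g ⊛ h)) (suc n) ∎
    where
    open ≡-Reasoning
    lem : ∀ a b c d e → a ℤ.* b ℤ.* c ℤ.+ (a ℤ.* d ℤ.+ e) ≡ a ℤ.* (b ℤ.* c ℤ.+ d) ℤ.+ e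
    lem = solve-∀

  zeroS-⊛ : ∀ f → zeroS ⊛ f ≐ zeroS
  zeroS-⊛ f zero    = ⊛-zero zeroS f
  zeroS-⊛ f (suc n) = trans (⊛-sucˡ zeroS f n) (trans (ℤ.+-identityˡ _) (zeroS-⊛ f n))

  one-⊛ : ∀ f → one ⊛ f ≐ f
  one-⊛ f zero    = trans (⊛-zero one f) (ℤ.*-identityˡ (f 0))
  one-⊛ f (suc n) = trans (⊛-sucˡ one f n)
    (trans (cong₂ ℤ._+_ (ℤ.*-identityˡ (f (suc n))) (zeroS-⊛ f n)) (ℤ.+-identityʳ _))


  FPS-setoid : Setoid 0ℓ 0ℓ
  FPS-setoid = record
    { Carrier = FPS ; _≈_ = _≐_
    ; isEquivalence = record
      { refl = λ _ → refl ; sym = λ p n → sym (p n) ; trans = λ p q n → trans (p n) (q n) } }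

  FPS-commutativeRing : CommutativeRing 0ℓ 0ℓ
  FPS-commutativeRing = record
    { Carrier = FPS ; _≈_ = _≐_ ; _+_ = _⊕_ ; _*_ = _⊛_ ; -_ = ⊖_ ; 0# = zeroS ; 1# = one
    ; isCommutativeRing = record
      { isRing = record
        { +-isAbelianGroup = record
          { isGroup = record
            { isMonoid = record
              { isSemigroup = record
                { isMagma = record
                  { isEquivalence = Setoid.isEquivalence FPS-setoid
                  ; ∙-cong = λ p q n → cong₂ ℤ._+_ (p n) (q n) }
                ; assoc = λ f g h n → ℤ.+-assoc (f n) (g n) (h n) }
              ; identity = (λ f n → ℤ.+-identityˡ (f n)) , (λ f n → ℤ.+-identityʳ (f n)) }
            ; inverse = (λ f n → ℤ.+-inverseˡ (f n)) , (λ f n → ℤ.+-inverseʳ (f n))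
            ; ⁻¹-cong = λ p n → cong ℤ.-_ (p n) }
          ; comm = λ f g n → ℤ.+-comm (f n) (g n) }
        ; *-cong = ⊛-cong
        ; *-assoc = ⊛-assoc
        ; *-identity = comm∧idˡ⇒id FPS-setoid ⊛-comm one-⊛
        ; distrib = comm∧distrʳ⇒distr FPS-setoid (λ p q n → cong₂ ℤ._+_ (p n) (q n)) ⊛-comm ⊛-distribʳ }
      ; *-comm = ⊛-comm } }

  -- Cross-multiplied solutions of the two recurrences, in any commutative ring

  module _ {a ℓ} (𝓡 : CommutativeRing a ℓ) where
    open CommutativeRing 𝓡 renaming (refl to ≈-refl; sym to ≈-sym; trans to ≈-trans)
    open import Algebra.Properties.Group +-group using (∙-cancelʳ)
    open import Algebra.Solver.Ring.NaturalCoefficients.Default commutativeSemiring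
      using (solve; _:+_; _:*_; _:=_; con)
    open import Relation.Binary.Reasoning.Setoid setoid

    -- Multiplying the recurrence by `R₁` linearises it, because `F′ * R₁` is `R₀`. Writing `R₁` as
    -- `R₂ + X * R₀` on the left produces the same `X * R₀ * F` on both sides. Cancelling it at the
    -- end keeps every identity free of subtraction, within reach of a semiring solver.
    avoider-ratio : ∀ {X F F′ R₀ R₁ R₂} → R₂ + X * R₀ ≈ R₁ → F ≈ 1# + X * (F′ * F) → F′ * R₁ ≈ R₀ →
                    F * R₂ ≈ R₁
    avoider-ratio {X} {F} {F′} {R₀} {R₁} {R₂} eR eF eF′ = ∙-cancelʳ (X * R₀ * F) _ _ (begin
      F * R₂ + X * R₀ * F          ≈⟨ solve 4 (λ x f a b → f :* b :+ x :* a :* f := f :* (b :+ x :* a)) ≈-refl X F R₀ R₂ ⟩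
      F * (R₂ + X * R₀)            ≈⟨ *-cong eF eR ⟩
      (1# + X * (F′ * F)) * R₁     ≈⟨ solve 4 (λ x f g b → (con 1 :+ x :* (g :* f)) :* b := b :+ x :* (g :* b) :* f) ≈-refl X F F′ R₁ ⟩
      R₁ + X * (F′ * R₁) * F       ≈⟨ +-congˡ (*-congʳ (*-congˡ eF′)) ⟩
      R₁ + X * R₀ * F              ∎)

    -- The recurrence is multiplied by `R₁ * R₂`. The term with `F′ * H` then cancels against the
    -- `X * R₀` part of `R₁`, and the subtracted `G` cancels against the main part of `G * F`. The
    -- value `E` of `G * R₁` is kept free: it is `R₀` when `G` is `F′`, and `R₁` when `G` is 1.
    container-ratio : ∀ {X F F′ G H H′ R₀ R₁ R₂ E} → R₂ + X * R₀ ≈ R₁ →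
      F′ * R₁ ≈ R₀ → F * R₂ ≈ R₁ → G * R₁ ≈ E →
      H + X * (X * G) ≈ X * (H′ * F + F′ * H) + X * (X * (G * F)) →
      H * (R₂ * R₂) ≈ X * (H′ * (R₁ * R₁)) + X * (X * (X * (E * R₀)))
    container-ratio {X} {F} {F′} {G} {H} {H′} {R₀} {R₁} {R₂} {E} eR eF′ eF eG eH =
      ∙-cancelʳ (X * (R₀ * (H * R₂)) + X * (X * (E * R₂))) _ _ (begin
        H * (R₂ * R₂) + (X * (R₀ * (H * R₂)) + X * (X * (E * R₂)))
          ≈⟨ solve 5 (λ x h a c e → h :* (c :* c) :+ (x :* (a :* (h :* c)) :+ x :* (x :* (e :* c)))
               := h :* ((c :+ x :* a) :* c) :+ x :* (x :* (e :* c))) ≈-refl X H R₀ R₂ E ⟩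
        H * ((R₂ + X * R₀) * R₂) + X * (X * (E * R₂))
          ≈⟨ +-cong (*-congˡ (*-congʳ eR)) (*-congˡ (*-congˡ (*-congʳ (≈-sym eG)))) ⟩
        H * (R₁ * R₂) + X * (X * (G * R₁ * R₂))
          ≈⟨ solve 5 (λ x h g b c → h :* (b :* c) :+ x :* (x :* (g :* b :* c))
               := (h :+ x :* (x :* g)) :* (b :* c)) ≈-refl X H G R₁ R₂ ⟩
        (H + X * (X * G)) * (R₁ * R₂)
          ≈⟨ *-congʳ eH ⟩
        (X * (H′ * F + F′ * H) + X * (X * (G * F))) * (R₁ * R₂)
          ≈⟨ solve 8 (λ x h h′ f f′ g b c → (x :* (h′ :* f :+ f′ :* h) :+ x :* (x :* (g :* f))) :* (b :* c)
               := x :* (h′ :* b :* (f :* c) :+ f′ :* b :* (h :* c)) :+ x :* (x :* (g :* b :* (f :* c))))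
               ≈-refl X H H′ F F′ G R₁ R₂ ⟩
        X * (H′ * R₁ * (F * R₂) + F′ * R₁ * (H * R₂)) + X * (X * (G * R₁ * (F * R₂)))
          -- Only in the last term is `F * R₂` rewritten to `R₂ + X * R₀` instead of `R₁`: this
          -- exposes the summand `X * (X * (E * R₂))` that cancels and leaves the cube.
          ≈⟨ +-cong (*-congˡ (+-cong (*-congˡ eF) (*-congʳ eF′))) (*-congˡ (*-congˡ (*-cong eG (≈-trans eF (≈-sym eR))))) ⟩
        X * (H′ * R₁ * R₁ + R₀ * (H * R₂)) + X * (X * (E * (R₂ + X * R₀)))
          ≈⟨ solve 7 (λ x h h′ a b c e → x :* (h′ :* b :* b :+ a :* (h :* c)) :+ x :* (x :* (e :* (c :+ x :* a)))
               := (x :* (h′ :* (b :* b)) :+ x :* (x :* (x :* (e :* a)))) :+ (x :* (a :* (h :* c)) :+ x :* (x :* (e :* c))))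
               ≈-refl X H H′ R₀ R₁ R₂ E ⟩
        (X * (H′ * (R₁ * R₁)) + X * (X * (X * (E * R₀)))) + (X * (R₀ * (H * R₂)) + X * (X * (E * R₂))) ∎)

    cube-split : ∀ X R → X * (X * (X * (R + X * 1#))) ≈ X * (X * (X * (R * 1#))) + X * (X * (X * (X * 1#)))
    cube-split = solve 2 (λ x r → x :* (x :* (x :* (r :+ x :* con 1)))
                   := x :* (x :* (x :* (r :* con 1))) :+ x :* (x :* (x :* (x :* con 1)))) ≈-refl

  -- The polynomials `R` and the recursion of the numerator in `k`

  module 𝔽 = CommutativeRing FPS-commutativeRing
  open 𝔽
    using (+-cong; +-congˡ; +-congʳ; *-cong; *-congˡ; *-congʳ; +-comm; +-assoc; setoid; distribˡ;
           -‿inverseˡ; +-identityʳ; +-group)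
    renaming (refl to ≐-refl; sym to ≐-sym; trans to ≐-trans)

  X : FPS
  X = xpow 1 one

  X⊛ : ∀ f → X ⊛ f ≐ xpow 1 f
  X⊛ f zero    = ⊛-zero X f
  X⊛ f (suc n) = trans (⊛-sucˡ X f n) (trans (ℤ.+-identityˡ _) (one-⊛ f n))

  xpow-suc : ∀ m f → xpow (suc m) f ≐ X ⊛ xpow m f
  xpow-suc m f n = trans (shift n) (sym (X⊛ (xpow m f) n))
    where
    shift : xpow (suc m) f ≐ xpow 1 (xpow m f)
    shift zero    = refl
    shift (suc n) = refl

  R-recurrence : ∀ j → R (suc (suc j)) ⊕ (X ⊛ R j) ≐ R (suc j)
  R-recurrence j n = trans (cong (λ z → R (suc j) n ℤ.+ ℤ.- xpow 1 (R j) n ℤ.+ z) (X⊛ (R j) n))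
                           (lem (R (suc j) n) (xpow 1 (R j) n))
    where
    lem : ∀ a b → a ℤ.+ ℤ.- b ℤ.+ b ≡ a
    lem = solve-∀

  xpow-sq : ℕ → ℕ → FPS
  xpow-sq k i = xpow (k ∸ i) (R (suc i) ⊛ R (suc i))

  -- Passing from `k` to `suc k` raises each exponent by one. The bound on the indices keeps
  -- `suc k ∸ i` from being truncated.
  foldr-X : ∀ k e e′ is → (∀ {i} → i ∈ is → i < suc k) → e′ ≐ X ⊛ e →
            foldr _⊕_ e′ (map (xpow-sq (suc k)) is) ≐ X ⊛ foldr _⊕_ e (map (xpow-sq k) is)
  foldr-X k e e′ []       _  eq = eq
  foldr-X k e e′ (i ∷ is) lt eq = begin
    xpow-sq (suc k) i ⊕ _
      ≈⟨ +-cong head-shift (foldr-X k e e′ is (lt ∘ there) eq) ⟩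
    (X ⊛ xpow-sq k i) ⊕ (X ⊛ foldr _⊕_ e (map (xpow-sq k) is))
      ≈⟨ distribˡ X (xpow-sq k i) (foldr _⊕_ e (map (xpow-sq k) is)) ⟨
    X ⊛ (xpow-sq k i ⊕ foldr _⊕_ e (map (xpow-sq k) is)) ∎
    where
    open SetoidReasoning setoid
    head-shift : xpow-sq (suc k) i ≐ X ⊛ xpow-sq k i
    head-shift rewrite ℕ.+-∸-assoc 1 {k} {i} (ℕ.≤-pred (lt (here refl))) = xpow-suc (k ∸ i) (R (suc i) ⊛ R (suc i))

  foldr-⊕ : ∀ e c fs → foldr _⊕_ (c ⊕ e) fs ≐ foldr _⊕_ e fs ⊕ c
  foldr-⊕ e c []       = +-comm c e
  foldr-⊕ e c (f ∷ fs) = ≐-trans (+-congˡ {f} (foldr-⊕ e c fs)) (≐-sym (+-assoc f (foldr _⊕_ e fs) c))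

  cube : FPS → FPS
  cube f = X ⊛ (X ⊛ (X ⊛ f))

  cube-cong : ∀ {f g} → f ≐ g → cube f ≐ cube g
  cube-cong p = *-congˡ {X} (*-congˡ {X} (*-congˡ {X} p))

  xpow3 : ∀ f → xpow 3 f ≐ cube f
  xpow3 f = ≐-trans (xpow-suc 2 f) (*-congˡ {X} (≐-trans (xpow-suc 1 f) (*-congˡ {X} (xpow-suc 0 f))))

  ⊖-cong : ∀ {f g} → f ≐ g → ⊖ f ≐ ⊖ g
  ⊖-cong p n = cong ℤ.-_ (p n)

  ⊖-X : ∀ f → X ⊛ (⊖ f) ≐ ⊖ (X ⊛ f)
  ⊖-X f zero = refl
  ⊖-X f (suc n) = trans (X⊛ (⊖ f) (suc n)) (cong ℤ.-_ (sym (X⊛ f (suc n))))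

  -- The new last index is `r`, whose exponent `(3 + r) ∸ r` is 3; all older terms gain one factor
  -- `X`. This is the shape of the conclusion of `container-ratio`.
  rhsNumerator-suc : ∀ r → rhsNumerator (3 ℕ.+ r) ≐
    (X ⊛ rhsNumerator (2 ℕ.+ r)) ⊕ cube (R (suc r) ⊛ R (suc r))
  rhsNumerator-suc r = begin
    foldr _⊕_ e′ (map g (upTo (suc r)))
      ≡⟨ cong (λ is → foldr _⊕_ e′ (map g is)) (upTo-∷ʳ r) ⟨
    foldr _⊕_ e′ (map g (upTo r ∷ʳ r))
      ≡⟨ cong (foldr _⊕_ e′) (map-++ g (upTo r) _) ⟩
    foldr _⊕_ e′ (map g (upTo r) ∷ʳ g r)
      ≡⟨ foldr-∷ʳ _⊕_ e′ (g r) (map g (upTo r)) ⟩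
    foldr _⊕_ (g r ⊕ e′) (map g (upTo r))
      ≈⟨ foldr-⊕ e′ (g r) (map g (upTo r)) ⟩
    foldr _⊕_ e′ (map g (upTo r)) ⊕ g r
      ≈⟨ +-cong (foldr-X (2 ℕ.+ r) e e′ (upTo r) (λ p → ℕ.m≤n⇒m≤o+n 3 (∈-upTo⁻ p)) e-shift) last-term ⟩
    (X ⊛ rhsNumerator (2 ℕ.+ r)) ⊕ cube (R (suc r) ⊛ R (suc r)) ∎
    where
    open SetoidReasoning setoid
    g = xpow-sq (3 ℕ.+ r)
    e = ⊖ xpow (3 ℕ.+ r) one
    e′ = ⊖ xpow (4 ℕ.+ r) one
    e-shift : e′ ≐ X ⊛ e
    e-shift = ≐-trans (⊖-cong (xpow-suc (3 ℕ.+ r) one)) (≐-sym (⊖-X (xpow (3 ℕ.+ r) one)))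
    last-term : g r ≐ cube (R (suc r) ⊛ R (suc r))
    last-term rewrite ℕ.m+n∸n≡m 3 r = xpow3 (R (suc r) ⊛ R (suc r))

  -- The numerator is x³ - x⁴, and R_2 is 1 - x. Adding x⁴ to both sides replaces the subtraction by
  -- the recurrence for R_2, via `cube-split`.
  rhsNumerator-3 : rhsNumerator 3 ≐ cube (R 2 ⊛ R 1)
  rhsNumerator-3 = ∙-cancelʳ (X ⊛ cube one) _ _ (begin
    ((xpow 3 (one ⊛ one) ⊕ (⊖ xpow 4 one)) ⊕ (X ⊛ cube one))
      ≈⟨ +-assoc (xpow 3 (one ⊛ one)) (⊖ xpow 4 one) (X ⊛ cube one) ⟩
    xpow 3 (one ⊛ one) ⊕ ((⊖ xpow 4 one) ⊕ (X ⊛ cube one))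
      ≈⟨ +-cong (≐-trans (xpow3 (one ⊛ one)) (cube-cong (one-⊛ one)))
           (+-congʳ (⊖-cong (≐-trans (xpow-suc 3 one) (*-congˡ {X} (xpow3 one))))) ⟩
    cube one ⊕ ((⊖ (X ⊛ cube one)) ⊕ (X ⊛ cube one))
      ≈⟨ +-congˡ {cube one} (-‿inverseˡ (X ⊛ cube one)) ⟩
    cube one ⊕ zeroS
      ≈⟨ +-identityʳ (cube one) ⟩
    cube one
      ≈⟨ cube-cong (R-recurrence 0) ⟨
    cube (R 2 ⊕ (X ⊛ R 0))
      ≈⟨ cube-split FPS-commutativeRing X (R 2) ⟩
    cube (R 2 ⊛ R 1) ⊕ (X ⊛ cube one) ∎)
    where
    open SetoidReasoning setoid
    open import Algebra.Properties.Group +-group using (∙-cancelʳ)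

open import Data.Nat
open import Data.Nat.Properties
open import Algebra.Properties.CommutativeSemigroup +-commutativeSemigroup using (interchange)
open import Data.Bool using (Bool; true; false; _∧_; if_then_else_; T)
open import Data.Empty using (⊥; ⊥-elim)
open import Data.Product using (_×_; _,_; proj₁; proj₂; ∃)
open import Data.Sum as Sum using (_⊎_; inj₁; inj₂; [_,_]′)
open import Data.List
  using (List; []; _∷_; _++_; _∷ʳ_; length; map; concatMap; cartesianProduct; cartesianProductWith;
         upTo; applyUpTo; drop; replicate; foldr)
open import Data.List.Properties
  using (length-++; length-map; length-upTo; length-applyUpTo; map-cong; map-upTo; map-injective;
         ∷-injective; ∷ʳ-++; ∷ʳ-injectiveˡ; ∷ʳ-injectiveʳ)
open import Data.List.Membership.Propositional using (_∈_; _∉_)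
open import Data.List.Membership.Propositional.Properties
import Data.List.Membership.DecPropositional _≟_ as DecMembership
open import Data.List.Relation.Unary.Any using (here; there)
open import Data.List.Relation.Unary.All as All using (All; []; _∷_)
import Data.List.Relation.Unary.All.Properties as All
open import Data.List.Relation.Unary.AllPairs as AllPairs using ([]; _∷_)
open import Data.List.Relation.Unary.Unique.Propositional using (Unique)
import Data.List.Relation.Unary.Unique.Propositional.Properties as Unique
open import Data.List.Relation.Binary.Subset.Propositional using (_⊆_)
open import Function using (_∘_; id)
open import Relation.Nullary using (¬_; yes; no; contradiction)
open import Relation.Binary.Definitions using (tri<; tri≈; tri>)
open import Relation.Binary.PropositionalEquality
  using (_≢_; refl; sym; trans; cong; cong₂; subst; subst₂; module ≡-Reasoning)

-- Cardinalities of predicates by duplicate-free enumeration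

infix 4 _⇔_
_⇔_ : {A : Set} → (A → Set) → (A → Set) → Set
P ⇔ Q = ∀ {a} → (P a → Q a) × (Q a → P a)

-- The size depends on the predicate alone (`Enum-size`), so a recurrence is obtained by enumerating
-- one set in two ways, without constructing a bijection between lists.
record Enum {A : Set} (P : A → Set) (m : ℕ) : Set where
  constructor enum
  field
    elements : List A
    unique   : Unique elements
    size     : length elements ≡ m
    sound    : ∀ {a} → a ∈ elements → P a
    complete : ∀ {a} → P a → a ∈ elements

Σ< : ℕ → (ℕ → ℕ) → ℕ
Σ< zero    g = 0
Σ< (suc N) g = g 0 + Σ< N (λ i → g (suc i))

module _ {A : Set} where

  -- Pigeonhole by cutting the head of `xs` out of `ys`: uniqueness keeps the rest of `xs` inside
  -- what remains.
  Unique⊆⇒length≤ : {xs ys : List A} → Unique xs → xs ⊆ ys → length xs ≤ length ys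
  Unique⊆⇒length≤ {[]} _ _ = z≤n
  Unique⊆⇒length≤ {x ∷ xs} (x≢ ∷ uxs) sub with ∈-∃++ (sub (here refl))
  ... | as , bs , refl = begin
    suc (length xs)               ≤⟨ s≤s (Unique⊆⇒length≤ uxs sub′) ⟩
    suc (length (as ++ bs))       ≡⟨ cong suc (length-++ as) ⟩
    suc (length as + length bs)   ≡⟨ +-suc (length as) (length bs) ⟨
    length as + suc (length bs)   ≡⟨ length-++ as ⟨
    length (as ++ x ∷ bs)         ∎
    where
    open ≤-Reasoning
    sub′ : xs ⊆ as ++ bs
    sub′ p with ∈-++⁻ as (sub (there p))
    ... | inj₁ q         = ∈-++⁺ˡ q
    ... | inj₂ (here e)  = ⊥-elim (All.lookup x≢ p (sym e))
    ... | inj₂ (there q) = ∈-++⁺ʳ as q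

  Enum-size-≤ : {P Q : A → Set} {m n : ℕ} → Enum P m → Enum Q n → (∀ {a} → P a → Q a) → m ≤ n
  Enum-size-≤ (enum _ u refl s _) (enum _ _ refl _ c) PQ = Unique⊆⇒length≤ u (λ p → c (PQ (s p)))

  Enum-size : {P Q : A → Set} {m n : ℕ} → Enum P m → Enum Q n → P ⇔ Q → m ≡ n
  Enum-size e e′ PQ = ≤-antisym (Enum-size-≤ e e′ (proj₁ PQ)) (Enum-size-≤ e′ e (proj₂ PQ))

  Enum-cong : {P Q : A → Set} {m : ℕ} → P ⇔ Q → Enum P m → Enum Q m
  Enum-cong PQ (enum xs u l s c) = enum xs u l (λ p → proj₁ PQ (s p)) (λ q → c (proj₂ PQ q))

  Enum-⊥ : {P : A → Set} → (∀ {a} → ¬ P a) → Enum P 0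
  Enum-⊥ ¬P = enum [] [] refl (λ ()) (λ p → ⊥-elim (¬P p))

  Enum-singleton : (a : A) → Enum (_≡ a) 1
  Enum-singleton a = enum (a ∷ []) ([] ∷ []) refl (λ { (here e) → e }) here

  Enum-⊎ : {P Q : A → Set} {m n : ℕ} → (∀ {a} → P a → ¬ Q a) →
           Enum P m → Enum Q n → Enum (λ a → P a ⊎ Q a) (m + n)
  Enum-⊎ disj (enum xs u refl s c) (enum ys v refl t d) =
    enum (xs ++ ys) (Unique.++⁺ u v (λ (p , q) → disj (s p) (t q))) (length-++ xs)
      (λ p → Sum.map s t (∈-++⁻ xs p))
      [ (λ p → ∈-++⁺ˡ (c p)) , (λ q → ∈-++⁺ʳ xs (d q)) ]′

  Enum-⋃ : {P : ℕ → A → Set} {m : ℕ → ℕ} (N : ℕ) →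
           (∀ {i j a} → i < N → j < N → P i a → P j a → i ≡ j) →
           (∀ i → i < N → Enum (P i) (m i)) → Enum (λ a → ∃ λ i → i < N × P i a) (Σ< N m)
  Enum-⋃ zero _ _ = Enum-⊥ λ ()
  Enum-⋃ {P} (suc N) disj e =
    Enum-cong (λ {a} → to a , from a)
      (Enum-⊎ (λ p (i , i<N , q) → 0≢1+n (disj z<s (s≤s i<N) p q)) (e 0 z<s)
        (Enum-⋃ N (λ i<N j<N p q → suc-injective (disj (s≤s i<N) (s≤s j<N) p q))
                  (λ i i<N → e (suc i) (s≤s i<N))))
    where
    to : ∀ a → P 0 a ⊎ (∃ λ i → i < N × P (suc i) a) → ∃ λ i → i < suc N × P i a
    to a (inj₁ p)             = 0 , z<s , p
    to a (inj₂ (i , i<N , p)) = suc i , s≤s i<N , p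
    from : ∀ a → (∃ λ i → i < suc N × P i a) → P 0 a ⊎ (∃ λ i → i < N × P (suc i) a)
    from a (zero  , _       , p) = inj₁ p
    from a (suc i , s≤s i<N , p) = inj₂ (i , i<N , p)

module _ {A B : Set} where

  length-cartesianProduct : (xs : List A) (ys : List B) →
                            length (cartesianProduct xs ys) ≡ length xs * length ys
  length-cartesianProduct []       ys = refl
  length-cartesianProduct (x ∷ xs) ys =
    trans (length-++ (map (x ,_) ys)) (cong₂ _+_ (length-map _ ys) (length-cartesianProduct xs ys))

  Enum-× : {P : A → Set} {Q : B → Set} {m n : ℕ} → Enum P m → Enum Q n →
           Enum (λ (a , b) → P a × Q b) (m * n)
  Enum-× (enum xs u refl s c) (enum ys v refl t d) =
    enum (cartesianProduct xs ys) (Unique.cartesianProduct⁺ u v) (length-cartesianProduct xs ys)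
      (λ p → let p₁ , p₂ = ∈-cartesianProduct⁻ xs ys p in s p₁ , t p₂)
      (λ (p , q) → ∈-cartesianProduct⁺ (c p) (d q))

  Unique-map : (f : A → B) {xs : List A} →
               (∀ {a b} → a ∈ xs → b ∈ xs → f a ≡ f b → a ≡ b) → Unique xs → Unique (map f xs)
  Unique-map f {[]}     _   _         = []
  Unique-map f {x ∷ xs} inj (x≢ ∷ u) =
    All.tabulate (λ p e → let a , a∈ , eq = ∈-map⁻ f p in
      All.lookup x≢ a∈ (inj (here refl) (there a∈) (trans e eq)))
    ∷ Unique-map f (λ p q → inj (there p) (there q)) u

  -- Injectivity is asked on `P` only: the words glued together at the maximum can be taken apart
  -- again because their entries are bounded.
  Enum-image : {P : A → Set} {m : ℕ} (f : A → B) →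
               (∀ {a b} → P a → P b → f a ≡ f b → a ≡ b) →
               Enum P m → Enum (λ b → ∃ λ a → P a × b ≡ f a) m
  Enum-image {P} f inj (enum xs u l s c) =
    enum (map f xs) (Unique-map f (λ p q → inj (s p) (s q)) u) (trans (length-map f xs) l)
      (λ p → let a , a∈ , eq = ∈-map⁻ f p in a , s a∈ , eq)
      (λ { (a , p , refl) → ∈-map⁺ f (c p) })

-- Boolean comparison and counting

<ᵇ-true : ∀ {x y} → x < y → (x <ᵇ y) ≡ true
<ᵇ-true {x} {y} p with x <ᵇ y | <⇒<ᵇ p
... | true | _ = refl

<ᵇ-false : ∀ {x y} → y ≤ x → (x <ᵇ y) ≡ false
<ᵇ-false {x} {y} p with x <ᵇ y in eq
... | false = refl
... | true  = ⊥-elim (<⇒≱ (<ᵇ⇒< x y (subst T (sym eq) _)) p)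

<ᵇ-true⁻ : ∀ {x y} → (x <ᵇ y) ≡ true → x < y
<ᵇ-true⁻ {x} {y} eq = <ᵇ⇒< x y (subst T (sym eq) _)

module _ {A : Set} where

  countB-cong : {p q : A → Bool} → (∀ z → p z ≡ q z) → ∀ w → countB p w ≡ countB q w
  countB-cong eq []      = refl
  countB-cong {p} {q} eq (z ∷ w) rewrite eq z | countB-cong {p} {q} eq w = refl

  countB-++ : (p : A → Bool) (v w : List A) → countB p (v ++ w) ≡ countB p v + countB p w
  countB-++ p []      w = refl
  countB-++ p (z ∷ v) w with p z
  ... | true  = cong suc (countB-++ p v w)
  ... | false = countB-++ p v w

  countB-map : {B : Set} (p : A → Bool) (f : B → A) (w : List B) → countB p (map f w) ≡ countB (p ∘ f) w
  countB-map p f []      = refl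
  countB-map p f (z ∷ w) rewrite countB-map p f w = refl

  countB≡0 : {p : A → Bool} (w : List A) → (∀ {z} → z ∈ w → p z ≡ false) → countB p w ≡ 0
  countB≡0 []      none = refl
  countB≡0 (z ∷ w) none rewrite none (here refl) = countB≡0 w (none ∘ there)

  countB>0 : {p : A → Bool} {w : List A} {z : A} → z ∈ w → p z ≡ true → 0 < countB p w
  countB>0 {p} {x ∷ w} (here refl) pz rewrite pz = z<s
  countB>0 {p} {x ∷ w} (there z∈)  pz with p x
  ... | true  = z<s
  ... | false = countB>0 z∈ pz

  countB≡0⁻ : {p : A → Bool} {w : List A} {z : A} → countB p w ≡ 0 → z ∈ w → p z ≡ false
  countB≡0⁻ {p} {z = z} eq z∈ with p z in pz
  ... | false = refl
  ... | true  = ⊥-elim (<⇒≢ (countB>0 z∈ pz) (sym eq))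

  countB>0⁻ : {p : A → Bool} (w : List A) → 0 < countB p w → ∃ λ z → z ∈ w × p z ≡ true
  countB>0⁻ {p} (x ∷ w) pos with p x in px
  ... | true  = x , here refl , px
  ... | false = let z , z∈ , pz = countB>0⁻ w pos in z , there z∈ , pz

  countB≡1⁻ : {p : A → Bool} (w : List A) → countB p w ≡ 1 →
              ∃ λ b → b ∈ w × p b ≡ true × (∀ {z} → z ∈ w → p z ≡ true → z ≡ b)
  countB≡1⁻ {p} (x ∷ w) eq with p x in px
  ... | true  = x , here refl , px , λ
    { (here e) _   → e
    ; (there z∈) pz → ⊥-elim (<⇒≢ (countB>0 z∈ pz) (sym (suc-injective eq))) }
  ... | false with countB≡1⁻ w eq
  ...   | b , b∈ , pb , only = b , there b∈ , pb , λ
    { (here refl) pz → contradiction (trans (sym px) pz) λ ()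
    ; (there z∈) pz  → only z∈ pz }

  countB≡1 : {p : A → Bool} {w : List A} {b : A} → Unique w → b ∈ w → p b ≡ true →
             (∀ {z} → z ∈ w → p z ≡ true → z ≡ b) → countB p w ≡ 1
  countB≡1 {p} {x ∷ w} (x≢ ∷ u) (here refl) pb only rewrite pb =
    cong suc (countB≡0 w λ {z} z∈ → no-other z z∈)
    where
    no-other : ∀ z → z ∈ w → p z ≡ false
    no-other z z∈ with p z in pz
    ... | false = refl
    ... | true  = ⊥-elim (All.lookup x≢ z∈ (sym (only (there z∈) pz)))
  countB≡1 {p} {x ∷ w} (x≢ ∷ u) (there b∈) pb only with p x in px
  ... | true  = ⊥-elim (All.lookup x≢ b∈ (only (here refl) px))
  ... | false = countB≡1 u b∈ pb (only ∘ there)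

-- Structural forms of the two patterns, and their invariance under order embeddings

-- With `x` and `y` as the letters 1 and 3, this counts the candidates for the letter 2 behind them.
-- The next two functions sum over the letter 3 and then over the letter 1, so occurrences are
-- counted by recursion on the word instead of over index triples.
count32 : ℕ → ℕ → List ℕ → ℕ
count32 x y = countB (λ z → (x <ᵇ z) ∧ (z <ᵇ y))

count132From : ℕ → List ℕ → ℕ
count132From x []      = 0
count132From x (y ∷ w) = count32 x y w + count132From x w

count132 : List ℕ → ℕ
count132 []      = 0
count132 (x ∷ w) = count132From x w + count132 w

-- An occurrence of 21-3-⋯-(r+2) is a descent ba followed by an ascending chain of length r above b.
data Ascends : ℕ → ℕ → List ℕ → Set where
  stop : ∀ {b w} → Ascends 0 b w
  skip : ∀ {r b x w} → Ascends r b w → Ascends r b (x ∷ w)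
  take : ∀ {r b x w} → b < x → Ascends r x w → Ascends (suc r) b (x ∷ w)

data Contains (r : ℕ) : List ℕ → Set where
  here  : ∀ {b a w} → a < b → Ascends r b w → Contains r (b ∷ a ∷ w)
  there : ∀ {x w} → Contains r w → Contains r (x ∷ w)

-- An equation of Booleans covers preservation and reflection of order at once, and lets counts be
-- transported by rewriting their test.
Embedding : (ℕ → ℕ) → Set
Embedding φ = ∀ x y → (φ x <ᵇ φ y) ≡ (x <ᵇ y)

module _ {φ : ℕ → ℕ} (mono : Embedding φ) where

  embedding-< : ∀ {x y} → x < y → φ x < φ y
  embedding-< {x} {y} p = <ᵇ-true⁻ (trans (mono x y) (<ᵇ-true p))

  embedding-<⁻ : ∀ {x y} → φ x < φ y → x < y
  embedding-<⁻ {x} {y} p = <ᵇ-true⁻ (trans (sym (mono x y)) (<ᵇ-true p))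

  embedding-injective : ∀ {x y} → φ x ≡ φ y → x ≡ y
  embedding-injective {x} {y} eq with <-cmp x y
  ... | tri< p _ _ = ⊥-elim (<⇒≢ (embedding-< p) eq)
  ... | tri≈ _ p _ = p
  ... | tri> _ _ p = ⊥-elim (<⇒≢ (embedding-< p) (sym eq))

  count32-map : ∀ x y w → count32 (φ x) (φ y) (map φ w) ≡ count32 x y w
  count32-map x y w = trans (countB-map _ φ w)
    (countB-cong (λ z → cong₂ _∧_ (mono x z) (mono z y)) w)

  count132From-map : ∀ x w → count132From (φ x) (map φ w) ≡ count132From x w
  count132From-map x []      = refl
  count132From-map x (y ∷ w) = cong₂ _+_ (count32-map x y w) (count132From-map x w)

  count132-map : ∀ w → count132 (map φ w) ≡ count132 w
  count132-map []      = refl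
  count132-map (x ∷ w) = cong₂ _+_ (count132From-map x w) (count132-map w)

  Ascends-map : ∀ {r b w} → Ascends r b w → Ascends r (φ b) (map φ w)
  Ascends-map stop       = stop
  Ascends-map (skip p)   = skip (Ascends-map p)
  Ascends-map (take l p) = take (embedding-< l) (Ascends-map p)

  Ascends-map⁻ : ∀ {r b} w → Ascends r (φ b) (map φ w) → Ascends r b w
  Ascends-map⁻ []      stop       = stop
  Ascends-map⁻ (x ∷ w) stop       = stop
  Ascends-map⁻ (x ∷ w) (skip p)   = skip (Ascends-map⁻ w p)
  Ascends-map⁻ (x ∷ w) (take l p) = take (embedding-<⁻ l) (Ascends-map⁻ w p)

  Contains-map : ∀ {r w} → Contains r w → Contains r (map φ w)
  Contains-map (here l p) = here (embedding-< l) (Ascends-map p)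
  Contains-map (there p)  = there (Contains-map p)

  Contains-map⁻ : ∀ {r} w → Contains r (map φ w) → Contains r w
  Contains-map⁻ (b ∷ a ∷ w) (here l p) = here (embedding-<⁻ l) (Ascends-map⁻ w p)
  Contains-map⁻ (x ∷ w)     (there p)  = there (Contains-map⁻ w p)

_≻_ : List ℕ → List ℕ → Set
u ≻ v = ∀ {x y} → x ∈ u → y ∈ v → y < x

-- Counting occurrences of 132 in a concatenation

count132From-++ : ∀ x u t → (∀ {y} → y ∈ u → count32 x y t ≡ 0) →
                  count132From x (u ++ t) ≡ count132From x u + count132From x t
count132From-++ x []      t none = refl
count132From-++ x (y ∷ u) t none
  rewrite countB-++ (λ z → (x <ᵇ z) ∧ (z <ᵇ y)) u t | none (here refl)
        | count132From-++ x u t (none ∘ there) | +-identityʳ (count32 x y u) =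
  sym (+-assoc (count32 x y u) _ _)

-- An occurrence across the cut has its 1 and 3 in `u`, or only its 1; each hypothesis rules out one
-- of the two kinds.
count132-++ : ∀ u t → (∀ {x y} → x ∈ u → y ∈ u → count32 x y t ≡ 0) →
              (∀ {x} → x ∈ u → count132From x t ≡ 0) →
              count132 (u ++ t) ≡ count132 u + count132 t
count132-++ []      t none none′ = refl
count132-++ (x ∷ u) t none none′
  rewrite count132From-++ x u t (none (here refl) ∘ there) | none′ (here refl)
        | +-identityʳ (count132From x u)
        | count132-++ u t (λ p q → none (there p) (there q)) (none′ ∘ there) =
  sym (+-assoc (count132From x u) _ _)

∧-falseʳ : ∀ b → b ∧ false ≡ false
∧-falseʳ true  = refl
∧-falseʳ false = refl

count32-low : ∀ x y v → All (_≤ x) v → count32 x y v ≡ 0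
count32-low x y v low = countB≡0 v λ {z} z∈ → cong (_∧ (z <ᵇ y)) (<ᵇ-false (All.lookup low z∈))

count32-max : ∀ x y n v → y ≤ n → All (_≤ x) v → count32 x y (n ∷ v) ≡ 0
count32-max x y n v y≤n low rewrite <ᵇ-false y≤n | ∧-falseʳ (x <ᵇ n) = count32-low x y v low

count132From-low : ∀ x v → All (_≤ x) v → count132From x v ≡ 0
count132From-low x []      _           = refl
count132From-low x (y ∷ v) (_ ∷ low) = cong₂ _+_ (count32-low x y v low) (count132From-low x v low)

count132From-max : ∀ n v → All (_< n) v → count132 (n ∷ v) ≡ count132 v
count132From-max n v v<n = cong (_+ count132 v) (count132From-low n v (All.map <⇒≤ v<n))

-- The entry `n` can only be the letter 3, and any occurrence across the cut would put a 1 in `u`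
-- below a 2 in `v`.
count132-++-max : ∀ u n v → All (_< n) u → All (_< n) v → u ≻ v →
                  count132 (u ++ n ∷ v) ≡ count132 u + count132 v
count132-++-max u n v u<n v<n u≻v = begin
  count132 (u ++ n ∷ v)        ≡⟨ count132-++ u (n ∷ v)
                                    (λ {x} {y} p q → count32-max x y n v (<⇒≤ (All.lookup u<n q)) (low p))
                                    (λ {x} p → cong₂ _+_ (count32-low x n v (low p)) (count132From-low x v (low p))) ⟩
  count132 u + count132 (n ∷ v) ≡⟨ cong (count132 u +_) (count132From-max n v v<n) ⟩
  count132 u + count132 v       ∎
  where
  open ≡-Reasoning
  low : ∀ {x} → x ∈ u → All (_≤ x) v
  low p = All.tabulate (λ q → <⇒≤ (u≻v p q))

record OnlyAbove (a b : ℕ) (v : List ℕ) : Set where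
  field
    member : b ∈ v
    above  : a < b
    only   : ∀ {z} → z ∈ v → a < z → z ≡ b

-- As the letter 1, `a` would need two different larger values behind it, but only `b` is available.
count132From-onlyAbove : ∀ a b v → (∀ {z} → z ∈ v → a < z → z ≡ b) → count132From a v ≡ 0
count132From-onlyAbove a b []      only = refl
count132From-onlyAbove a b (y ∷ v) only =
  cong₂ _+_ (countB≡0 v λ {z} z∈ → no-32 z (only (there z∈))) (count132From-onlyAbove a b v (only ∘ there))
  where
  no-32 : ∀ z → (a < z → z ≡ b) → (a <ᵇ z) ∧ (z <ᵇ y) ≡ false
  no-32 z z-only with a <ᵇ z in az | z <ᵇ y in zy
  ... | false | _     = refl
  ... | true  | false = refl
  ... | true  | true  = ⊥-elim (<⇒≢ (<ᵇ-true⁻ zy)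
    (trans (z-only (<ᵇ-true⁻ az)) (sym (only (here refl) (<-trans (<ᵇ-true⁻ az) (<ᵇ-true⁻ {z} zy))))))

∧-true : ∀ {x y} → x ≡ true → y ≡ true → x ∧ y ≡ true
∧-true refl refl = refl

∧-true⁻ : ∀ {x y} → x ∧ y ≡ true → x ≡ true × y ≡ true
∧-true⁻ {true} {true} _ = refl , refl

-- The additional occurrence is `a n b`. Entries of `u` exceed everything in `a ∷ v`, so none starts
-- an occurrence that leaves `u`; for `a` as the 1 and `n` as the 3, `b` is the only possible 2, and
-- it appears once.
count132-++-min-max : ∀ u a b n v → All (_< n) u → All (_< n) v → a < n → Unique v → u ≻ (a ∷ v) →
                      OnlyAbove a b v →
                      count132 (u ++ a ∷ n ∷ v) ≡ suc (count132 u + count132 v)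
count132-++-min-max u a b n v u<n v<n a<n uv u≻av ab = begin
  count132 (u ++ a ∷ n ∷ v)
    ≡⟨ count132-++ u (a ∷ n ∷ v) (λ {x} {y} p q → count32≡0 x y p q) (λ {x} p → count132From≡0 x p) ⟩
  count132 u + (count32 a n v + count132From a v + count132 (n ∷ v))
    ≡⟨ cong (λ c → count132 u + (c + count132 (n ∷ v)))
         (cong₂ _+_ (countB≡1 uv member (∧-true (<ᵇ-true above) (<ᵇ-true (All.lookup v<n member)))
                       (λ {z} z∈ t → only z∈ (<ᵇ-true⁻ {a} (proj₁ (∧-true⁻ {a <ᵇ z} t)))))
                    (count132From-onlyAbove a b v only)) ⟩
  count132 u + suc (count132 (n ∷ v))
    ≡⟨ cong (λ c → count132 u + suc c) (count132From-max n v v<n) ⟩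
  count132 u + suc (count132 v)
    ≡⟨ +-suc (count132 u) (count132 v) ⟩
  suc (count132 u + count132 v) ∎
  where
  open ≡-Reasoning
  open OnlyAbove ab
  low : ∀ {x} → x ∈ u → All (_≤ x) v
  low p = All.tabulate (λ q → <⇒≤ (u≻av p (there q)))
  count32≡0 : ∀ x y → x ∈ u → y ∈ u → count32 x y (a ∷ n ∷ v) ≡ 0
  count32≡0 x y p q rewrite <ᵇ-false (<⇒≤ (u≻av p (here refl))) =
    count32-max x y n v (<⇒≤ (All.lookup u<n q)) (low p)
  count132From≡0 : ∀ x → x ∈ u → count132From x (a ∷ n ∷ v) ≡ 0
  count132From≡0 x p = cong₂ _+_ (count32-max x a n v (<⇒≤ a<n) (low p))
    (cong₂ _+_ (count32-low x n v (low p)) (count132From-low x v (low p)))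

-- Each entry `z` of `v` above `x` contributes the occurrence `x n z`.
count132From-≥ : ∀ x u n v → All (_< n) v → countB (x <ᵇ_) v ≤ count132From x (u ++ n ∷ v)
count132From-≥ x (y ∷ u) n v v<n = ≤-trans (count132From-≥ x u n v v<n) (m≤n+m _ (count32 x y (u ++ n ∷ v)))
count132From-≥ x []      n v v<n = ≤-trans (≤-reflexive (sym (eq v v<n))) (m≤m+n _ (count132From x v))
  where
  eq : ∀ v → All (_< n) v → count32 x n v ≡ countB (x <ᵇ_) v
  eq []      _           = refl
  eq (z ∷ v) (z<n ∷ v<n) rewrite <ᵇ-true z<n | eq v v<n with x <ᵇ z
  ... | true  = refl
  ... | false = refl

data Shape (u v : List ℕ) : Set where
  dominating : u ≻ v → Shape u v
  one-exception : ∀ u₁ a b → u ≡ u₁ ∷ʳ a → u₁ ≻ v → OnlyAbove a b v → Shape u v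

-- If x < z with x before n and z after it, then xnz is an occurrence of 132; an entry y between x
-- and n gives a second one, namely xyz or ynz.
shape : ∀ u n v → All (_< n) v → (∀ {x} → x ∈ u → x ∉ v) → count132 (u ++ n ∷ v) ≤ 1 → Shape u v
shape []      n v v<n disj le = dominating λ ()
shape (x ∷ u) n v v<n disj le with countB (x <ᵇ_) v in cx
... | zero = extend (shape u n v v<n (disj ∘ there) (≤-trans (m≤n+m _ (count132From x (u ++ n ∷ v))) le))
  where
  x-above : ∀ {y} → y ∈ v → y < x
  x-above {y} y∈ with <-cmp x y
  ... | tri< x<y _ _ = contradiction (trans (sym (<ᵇ-true x<y)) (countB≡0⁻ {w = v} cx y∈)) λ ()
  ... | tri≈ _ refl _ = ⊥-elim (disj (here refl) y∈)
  ... | tri> _ _ y<x = y<x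
  cons : ∀ {u} → u ≻ v → (x ∷ u) ≻ v
  cons u≻v (here refl) = x-above
  cons u≻v (there p)   = u≻v p
  extend : Shape u v → Shape (x ∷ u) v
  extend (dominating u≻v)                   = dominating (cons u≻v)
  extend (one-exception u₁ a b eq u₁≻v ab) = one-exception (x ∷ u₁) a b (cong (x ∷_) eq) (cons u₁≻v) ab
shape (x ∷ []) n v v<n disj le | suc c =
  let b , b∈ , x<b , only = countB≡1⁻ v count≡1
  in one-exception [] x b refl (λ ()) (record
       { member = b∈ ; above = <ᵇ-true⁻ {x} x<b ; only = λ z∈ x<z → only z∈ (<ᵇ-true x<z) })
  where
  count≡1 : countB (x <ᵇ_) v ≡ 1
  count≡1 = ≤-antisym
    (≤-trans (count132From-≥ x [] n v v<n) (≤-trans (m≤m+n _ (count132 (n ∷ v))) le))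
    (subst (1 ≤_) (sym cx) (s≤s z≤n))
shape (x ∷ y ∷ u) n v v<n disj le | suc c = ⊥-elim (<⇒≱ two le)
  where
  t = u ++ n ∷ v
  x-pos : 0 < countB (x <ᵇ_) v
  x-pos = subst (0 <_) (sym cx) z<s
  two : 2 ≤ count32 x y t + count132From x t + (count132From y t + count132 t)
  two with countB>0⁻ v x-pos
  ... | z , z∈ , xz with <-cmp z y
  ...   | tri< z<y _ _ = ≤-trans
      (+-mono-≤ (countB>0 (∈-++⁺ʳ u (there z∈)) (∧-true xz (<ᵇ-true z<y)))
                (≤-trans x-pos (count132From-≥ x u n v v<n)))
      (m≤m+n _ (count132From y t + count132 t))
  ...   | tri≈ _ refl _ = ⊥-elim (disj (there (here refl)) z∈)
  ...   | tri> _ _ y<z = +-mono-≤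
      (≤-trans (≤-trans x-pos (count132From-≥ x u n v v<n)) (m≤n+m _ (count32 x y t)))
      (≤-trans (≤-trans (countB>0 z∈ (<ᵇ-true y<z)) (count132From-≥ y u n v v<n)) (m≤m+n _ (count132 t)))

-- The pattern 21-3-⋯-k in a word cut at its maximum

Ascends-++ʳ : ∀ {r b} u {w} → Ascends r b w → Ascends r b (u ++ w)
Ascends-++ʳ []      p = p
Ascends-++ʳ (x ∷ u) p = skip (Ascends-++ʳ u p)

Ascends-++ˡ : ∀ {r b u} w → Ascends r b u → Ascends r b (u ++ w)
Ascends-++ˡ w stop       = stop
Ascends-++ˡ w (skip p)   = skip (Ascends-++ˡ w p)
Ascends-++ˡ w (take l p) = take l (Ascends-++ˡ w p)

Contains-++ʳ : ∀ {r} u {w} → Contains r w → Contains r (u ++ w)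
Contains-++ʳ []      p = p
Contains-++ʳ (x ∷ u) p = there (Contains-++ʳ u p)

Contains-++ˡ : ∀ {r u} w → Contains r u → Contains r (u ++ w)
Contains-++ˡ w (here l p) = here l (Ascends-++ˡ w p)
Contains-++ˡ w (there p)  = there (Contains-++ˡ w p)

¬Ascends-low : ∀ {r b} v → All (_≤ b) v → ¬ Ascends (suc r) b v
¬Ascends-low (x ∷ v) (_ ∷ low)   (skip p)   = ¬Ascends-low v low p
¬Ascends-low (x ∷ v) (x≤b ∷ _)   (take l _) = <⇒≱ l x≤b

-- Every letter of the chain exceeds `b`, so none lies in `v`, and `n` can only be the last one.
-- Dropping the last letter leaves a chain inside `u`.
Ascends-max⁻ : ∀ {r b} u n v → All (_< n) v → All (_≤ b) v → Ascends (suc r) b (u ++ n ∷ v) → Ascends r b u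
Ascends-max⁻         []      n v v<n low (skip p)           = ⊥-elim (¬Ascends-low v low p)
Ascends-max⁻ {zero}  []      n v v<n low (take _ _)         = stop
Ascends-max⁻ {suc r} []      n v v<n low (take _ p)         = ⊥-elim (¬Ascends-low v (All.map <⇒≤ v<n) p)
Ascends-max⁻         (x ∷ u) n v v<n low (skip p)           = skip (Ascends-max⁻ u n v v<n low p)
Ascends-max⁻ {zero}  (x ∷ u) n v v<n low (take _ _)         = stop
Ascends-max⁻ {suc r} (x ∷ u) n v v<n low (take b<x p)       =
  take b<x (Ascends-max⁻ u n v v<n (All.map (λ z≤b → ≤-trans z≤b (<⇒≤ b<x)) low) p)

Ascends-max : ∀ {r b n u} v → All (_< n) u → b < n → Ascends r b u → Ascends (suc r) b (u ++ n ∷ v)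
Ascends-max {u = u} v _           b<n stop       = Ascends-++ʳ u (take b<n stop)
Ascends-max         v (_ ∷ u<n)   b<n (skip p)   = skip (Ascends-max v u<n b<n p)
Ascends-max         v (x<n ∷ u<n) b<n (take l p) = take l (Ascends-max v u<n x<n p)

Contains-max : ∀ {r n u} v → All (_< n) u → Contains r u → Contains (suc r) (u ++ n ∷ v)
Contains-max v (b<n ∷ _ ∷ u<n) (here l p) = here l (Ascends-max v u<n b<n p)
Contains-max v (_ ∷ u<n)       (there p)  = there (Contains-max v u<n p)

-- A descent straddling u and n is impossible, so the last entry of u is never the start of an occurrence.
data InitDominates (v : List ℕ) : List ℕ → Set where
  []  : InitDominates v []
  [_] : ∀ x → InitDominates v (x ∷ [])
  _∷_ : ∀ {x y u} → All (_< x) v → InitDominates v (y ∷ u) → InitDominates v (x ∷ y ∷ u)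

≻⇒InitDominates-∷ʳ : ∀ {u v} a → u ≻ v → InitDominates v (u ∷ʳ a)
≻⇒InitDominates-∷ʳ {[]}        a u≻v = [ a ]
≻⇒InitDominates-∷ʳ {x ∷ []}    a u≻v = All.tabulate (u≻v (here refl)) ∷ [ a ]
≻⇒InitDominates-∷ʳ {x ∷ y ∷ u} a u≻v = All.tabulate (u≻v (here refl)) ∷ ≻⇒InitDominates-∷ʳ a (u≻v ∘ there)

≻⇒InitDominates : ∀ {u v} → u ≻ v → InitDominates v u
≻⇒InitDominates {[]}        u≻v = []
≻⇒InitDominates {x ∷ []}    u≻v = [ x ]
≻⇒InitDominates {x ∷ y ∷ u} u≻v = All.tabulate (u≻v (here refl)) ∷ ≻⇒InitDominates (u≻v ∘ there)

-- A descent from `n` into `v` would need a later letter above `n`, and an entry followed by `n` is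
-- no descent. A descent inside `u` starts before the last entry of `u`, hence above all of `v`, and
-- `Ascends-max⁻` applies.
Contains-max⁻ : ∀ {r u n v} → All (_< n) u → All (_< n) v → InitDominates v u →
                Contains (suc r) (u ++ n ∷ v) → Contains r u ⊎ Contains (suc r) v
Contains-max⁻ {v = x ∷ v} _ (x<n ∷ v<n) [] (here _ p)      = ⊥-elim (¬Ascends-low v (All.map <⇒≤ v<n) p)
Contains-max⁻ _           _   []    (there p)               = inj₂ p
Contains-max⁻ (x<n ∷ _)   _   [ x ] (here n<x _)            = ⊥-elim (<⇒≱ n<x (<⇒≤ x<n))
Contains-max⁻ _           v<n [ x ] (there p)               = Sum.map₁ there (Contains-max⁻ {u = []} [] v<n [] p)
Contains-max⁻ {u = x ∷ y ∷ u} _ v<n (v<x ∷ _) (here l p)    =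
  inj₁ (here l (Ascends-max⁻ u _ _ v<n (All.map <⇒≤ v<x) p))
Contains-max⁻ (_ ∷ u<n)   v<n (_ ∷ dom) (there p)           = Sum.map₁ there (Contains-max⁻ u<n v<n dom p)

-- Equivalent to u a avoiding 21-3-⋯-(r+2) whenever a is below every entry of u.
AvoidsBeforeMin : ℕ → List ℕ → Set
AvoidsBeforeMin zero    u = u ≡ []
AvoidsBeforeMin (suc r) u = ¬ Contains (suc r) u

Ascends-∷ʳ-low⁻ : ∀ {r b a} u → a ≤ b → Ascends r b (u ∷ʳ a) → Ascends r b u
Ascends-∷ʳ-low⁻ []      a≤b stop         = stop
Ascends-∷ʳ-low⁻ []      a≤b (skip stop)  = stop
Ascends-∷ʳ-low⁻ []      a≤b (take b<a _) = ⊥-elim (<⇒≱ b<a a≤b)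
Ascends-∷ʳ-low⁻ (x ∷ u) a≤b stop         = stop
Ascends-∷ʳ-low⁻ (x ∷ u) a≤b (skip p)     = skip (Ascends-∷ʳ-low⁻ u a≤b p)
Ascends-∷ʳ-low⁻ (x ∷ u) a≤b (take b<x p) = take b<x (Ascends-∷ʳ-low⁻ u (≤-trans a≤b (<⇒≤ b<x)) p)

-- The appended minimum is too small for the chain, and as the lower end of the descent it has
-- nothing behind it, whereas the chain is nonempty.
Contains-∷ʳ-min⁻ : ∀ {r a} u → All (a <_) u → Contains (suc r) (u ∷ʳ a) → Contains (suc r) u
Contains-∷ʳ-min⁻ []          _         (there ())
Contains-∷ʳ-min⁻ (x ∷ [])    _         (here _ ())
Contains-∷ʳ-min⁻ (x ∷ [])    _         (there (there ()))
Contains-∷ʳ-min⁻ (x ∷ y ∷ u) (a<x ∷ _) (here l p) = here l (Ascends-∷ʳ-low⁻ u (<⇒≤ a<x) p)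
Contains-∷ʳ-min⁻ (x ∷ y ∷ u) (_ ∷ a<u) (there p)  = there (Contains-∷ʳ-min⁻ (y ∷ u) a<u p)

Contains-0-∷ʳ-min : ∀ {a x} u → All (a <_) (x ∷ u) → Contains 0 (x ∷ u ∷ʳ a)
Contains-0-∷ʳ-min []      (a<x ∷ _) = here a<x stop
Contains-0-∷ʳ-min (y ∷ u) (_ ∷ a<u) = there (Contains-0-∷ʳ-min u a<u)

AvoidsBeforeMin⁺ : ∀ r {a} u → All (a <_) u → ¬ Contains r (u ∷ʳ a) → AvoidsBeforeMin r u
AvoidsBeforeMin⁺ zero    []      _   _  = refl
AvoidsBeforeMin⁺ zero    (x ∷ u) a<u ¬c = ⊥-elim (¬c (Contains-0-∷ʳ-min u a<u))
AvoidsBeforeMin⁺ (suc r) u       _   ¬c = ¬c ∘ Contains-++ˡ _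

AvoidsBeforeMin⁻ : ∀ r {a} u → All (a <_) u → AvoidsBeforeMin r u → ¬ Contains r (u ∷ʳ a)
AvoidsBeforeMin⁻ zero    []  _   refl (there ())
AvoidsBeforeMin⁻ (suc r) u   a<u ¬c   = ¬c ∘ Contains-∷ʳ-min⁻ u a<u

AvoidsBeforeMin-map : ∀ {φ} → Embedding φ → ∀ r u → AvoidsBeforeMin r u → AvoidsBeforeMin r (map φ u)
AvoidsBeforeMin-map mono zero    []  refl = refl
AvoidsBeforeMin-map mono (suc r) u   ¬c   = ¬c ∘ Contains-map⁻ mono u

AvoidsBeforeMin-map⁻ : ∀ {φ} → Embedding φ → ∀ r u → AvoidsBeforeMin r (map φ u) → AvoidsBeforeMin r u
AvoidsBeforeMin-map⁻ mono zero    []  _  = refl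
AvoidsBeforeMin-map⁻ mono (suc r) u   ¬c = ¬c ∘ Contains-map mono

-- Permutations cut at their maximum, and relabelling of values

record Perm (n : ℕ) (w : List ℕ) : Set where
  constructor perm
  field
    size    : length w ≡ n
    bounded : All (_< n) w
    nodup   : Unique w

-- Pigeonhole in an interval of values. It supplies the bounds that identify the values on either
-- side of the maximum.
Unique⇒length≤ : ∀ {a b w} → a ≤ b → Unique w → All (λ x → a ≤ x × x < b) w → a + length w ≤ b
Unique⇒length≤ {a} {b} {w} a≤b u bd = begin
  a + length w ≤⟨ +-monoʳ-≤ a (Unique⊆⇒length≤ u sub) ⟩
  a + length (applyUpTo (a +_) (b ∸ a)) ≡⟨ cong (a +_) (length-applyUpTo (a +_) (b ∸ a)) ⟩
  a + (b ∸ a) ≡⟨ m+[n∸m]≡n a≤b ⟩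
  b ∎
  where
  open ≤-Reasoning
  sub : ∀ {x} → x ∈ w → x ∈ applyUpTo (a +_) (b ∸ a)
  sub p with All.lookup bd p
  ... | a≤x , x<b = subst (_∈ _) (m+[n∸m]≡n a≤x) (∈-applyUpTo⁺ (a +_) (∸-monoˡ-< x<b a≤x))

record Split (n : ℕ) (u v : List ℕ) : Set where
  field
    u<n   : All (_< n) u
    v<n   : All (_< n) v
    uu    : Unique u
    uv    : Unique v
    disj  : ∀ {x} → x ∈ u → x ∉ v
    total : length u + length v ≡ n

Unique-++⁻ : ∀ (u : List ℕ) {v} → Unique (u ++ v) → Unique u × Unique v × (∀ {x} → x ∈ u → x ∉ v)
Unique-++⁻ []      uv        = [] , uv , λ ()
Unique-++⁻ (x ∷ u) (x≢ ∷ uv) with Unique-++⁻ u uv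
... | uu , uv′ , disj = All.++⁻ˡ u x≢ ∷ uu , uv′ , λ
  { (here refl) q → All.lookup (All.++⁻ʳ u x≢) q refl
  ; (there p)   q → disj p q }

<suc∧≢⇒< : ∀ {n} {w : List ℕ} → All (_< suc n) w → n ∉ w → All (_< n) w
<suc∧≢⇒< bd n∉ = All.tabulate λ p → ≤∧≢⇒< (≤-pred (All.lookup bd p)) λ { refl → n∉ p }

Perm-split : ∀ {n w} → Perm (suc n) w → ∃ λ u → ∃ λ v → w ≡ u ++ n ∷ v × Split n u v
Perm-split {n} {w} (perm size bd uw) with n DecMembership.∈? w
-- Without the value `n`, a word of `suc n` distinct entries would fit below `n`.
... | no n∉  = ⊥-elim (<-irrefl size (s≤s (Unique⇒length≤ z≤n uw (All.map (z≤n ,_) (<suc∧≢⇒< bd n∉)))))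
... | yes n∈ with ∈-∃++ n∈
...   | u , v , refl with Unique-++⁻ u uw
...     | uu , (n≢ ∷ uv) , disj = u , v , refl , record
  { u<n = <suc∧≢⇒< (All.++⁻ˡ u bd) (λ p → disj p (here refl))
  ; v<n = <suc∧≢⇒< (All.tail (All.++⁻ʳ u bd)) (λ p → All.lookup n≢ p refl)
  ; uu = uu ; uv = uv ; disj = λ p q → disj p (there q)
  ; total = suc-injective (trans (sym (+-suc (length u) (length v))) (trans (sym (length-++ u)) size)) }

Perm-join : ∀ {n u v} → Split n u v → Perm (suc n) (u ++ n ∷ v)
Perm-join {n} {u} {v} s = perm
  (trans (length-++ u) (trans (+-suc (length u) (length v)) (cong suc total)))
  (All.++⁺ (All.map m<n⇒m<1+n u<n) (n<1+n n ∷ All.map m<n⇒m<1+n v<n))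
  (Unique.++⁺ uu (All.map (λ y<n n≡y → <⇒≢ y<n (sym n≡y)) v<n ∷ uv) λ
    { (p , here refl) → <-irrefl refl (All.lookup u<n p)
    ; (p , there q)   → disj p q })
  where open Split s

∷-split-injective : ∀ {n : ℕ} (u u′ : List ℕ) {v v′} → n ∉ u → n ∉ u′ →
                    u ++ n ∷ v ≡ u′ ++ n ∷ v′ → u ≡ u′ × v ≡ v′
∷-split-injective []      []       _  _   refl = refl , refl
∷-split-injective []      (x ∷ u′) _  n∉′ refl = ⊥-elim (n∉′ (here refl))
∷-split-injective (x ∷ u) []       n∉ _   refl = ⊥-elim (n∉ (here refl))
∷-split-injective (x ∷ u) (y ∷ u′) n∉ n∉′ eq with ∷-injective eq
... | refl , eq′ with ∷-split-injective u u′ (n∉ ∘ there) (n∉′ ∘ there) eq′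
...   | refl , refl = refl , refl

preimage : ∀ {φ : ℕ → ℕ} w → (∀ {z} → z ∈ w → ∃ λ x → φ x ≡ z) → ∃ λ w₀ → w ≡ map φ w₀
preimage []      _   = [] , refl
preimage (z ∷ w) inv with inv (here refl) | preimage w (inv ∘ there)
... | x , refl | w₀ , refl = x ∷ w₀ , refl

Perm-preimage : ∀ {φ : ℕ → ℕ} {j} w₀ → length (map φ w₀) ≡ j → Unique (map φ w₀) →
                (∀ {x} → x ∈ w₀ → x < j) → Perm j w₀
Perm-preimage {φ} w₀ size u bd = perm (trans (sym (length-map φ w₀)) size) (All.tabulate bd) (Unique.map⁻ u)

shift-embedding : ∀ j → Embedding (j +_)
shift-embedding zero    x y = refl
shift-embedding (suc j) x y = shift-embedding j x y

-- The increasing enumeration of all naturals except `l`. It frees the value `l` on the right of the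
-- maximum, so that `l` can stand on the left.
skipOver : ℕ → ℕ → ℕ
skipOver zero    x       = suc x
skipOver (suc l) zero    = zero
skipOver (suc l) (suc x) = suc (skipOver l x)

skipOver-embedding : ∀ l → Embedding (skipOver l)
skipOver-embedding zero    x       y       = refl
skipOver-embedding (suc l) zero    zero    = refl
skipOver-embedding (suc l) zero    (suc y) = refl
skipOver-embedding (suc l) (suc x) zero    = refl
skipOver-embedding (suc l) (suc x) (suc y) = skipOver-embedding l x y

skipOver-≢ : ∀ l x → skipOver l x ≢ l
skipOver-≢ (suc l) (suc x) eq = skipOver-≢ l x (suc-injective eq)

skipOver-self : ∀ l → skipOver l l ≡ suc l
skipOver-self zero    = refl
skipOver-self (suc l) = cong suc (skipOver-self l)

skipOver-≤ : ∀ l x → skipOver l x ≤ suc x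
skipOver-≤ zero    x       = ≤-refl
skipOver-≤ (suc l) zero    = z≤n
skipOver-≤ (suc l) (suc x) = s≤s (skipOver-≤ l x)

skipOver-bounded⁻ : ∀ l x → skipOver l x ≤ suc l → x ≤ l
skipOver-bounded⁻ zero    x       (s≤s p) = p
skipOver-bounded⁻ (suc l) zero    _       = z≤n
skipOver-bounded⁻ (suc l) (suc x) (s≤s p) = s≤s (skipOver-bounded⁻ l x p)

skipOver-surjective : ∀ l z → z ≢ l → ∃ λ x → skipOver l x ≡ z
skipOver-surjective zero    zero    z≢ = ⊥-elim (z≢ refl)
skipOver-surjective zero    (suc z) _  = z , refl
skipOver-surjective (suc l) zero    _  = zero , refl
skipOver-surjective (suc l) (suc z) z≢ =
  let x , eq = skipOver-surjective l z (z≢ ∘ cong suc) in suc x , cong suc eq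

-- Decomposition of a permutation with at most one occurrence of 132

record Class (r c n : ℕ) (w : List ℕ) : Set where
  constructor class
  field
    isPerm : Perm n w
    avoid  : ¬ Contains r w
    count  : count132 w ≡ c

record LayeredPair (r c i j : ℕ) (ab : List ℕ × List ℕ) : Set where
  constructor layered
  field
    permˡ  : Perm i (proj₁ ab)
    avoidˡ : ¬ Contains r (proj₁ ab)
    permʳ  : Perm j (proj₂ ab)
    avoidʳ : ¬ Contains (suc r) (proj₂ ab)
    count  : count132 (proj₁ ab) + count132 (proj₂ ab) ≡ c

record CrossedPair (r c i j : ℕ) (ab : List ℕ × List ℕ) : Set where
  constructor crossed
  field
    permˡ  : Perm i (proj₁ ab)
    avoidˡ : AvoidsBeforeMin r (proj₁ ab)
    permʳ  : Perm j (proj₂ ab)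
    avoidʳ : ¬ Contains (suc r) (proj₂ ab)
    count  : suc (count132 (proj₁ ab) + count132 (proj₂ ab)) ≡ c

layer : ℕ → ℕ → List ℕ × List ℕ → List ℕ
layer n j (a , b) = map (j +_) a ++ n ∷ b

-- The entry l just before the maximum n and the largest entry l+1 after it form the only
-- occurrence of 132 meeting both sides of n.
cross : ℕ → ℕ → List ℕ × List ℕ → List ℕ
cross n l (a , b) = (map (2 + l +_) a ∷ʳ l) ++ n ∷ map (skipOver l) b

module Layer {i j n a b} (eq : i + j ≡ n) (pa : Perm i a) (pb : Perm j b) where
  private
    module a = Perm pa
    module b = Perm pb

  u≥j : ∀ {x} → x ∈ map (j +_) a → j ≤ x
  u≥j p with ∈-map⁻ (j +_) p
  ... | x , _ , refl = m≤m+n j x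

  u≻v : map (j +_) a ≻ b
  u≻v p q = <-≤-trans (All.lookup b.bounded q) (u≥j p)

  u<n : ∀ {x} → x ∈ map (j +_) a → x < n
  u<n p with ∈-map⁻ (j +_) p
  ... | x , x∈ , refl = subst (j + x <_) (trans (+-comm j i) eq) (+-monoʳ-< j (All.lookup a.bounded x∈))

  split : Split n (map (j +_) a) b
  split = record
    { u<n = All.tabulate u<n
    ; v<n = All.map (λ x<j → <-≤-trans x<j (subst (j ≤_) eq (m≤n+m j i))) b.bounded
    ; uu = Unique.map⁺ (embedding-injective (shift-embedding j)) a.nodup
    ; uv = b.nodup
    ; disj = λ p q → <-irrefl refl (u≻v p q)
    ; total = trans (cong₂ _+_ (trans (length-map (j +_) a) a.size) b.size) eq }

module Cross {i l n a b} (eq : 2 + i + l ≡ n) (pa : Perm i a) (pb : Perm (suc l) b) where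
  private
    module a = Perm pa
    module b = Perm pb

  u v : List ℕ
  u = map (2 + l +_) a
  v = map (skipOver l) b

  u≥ : ∀ {x} → x ∈ u → 2 + l ≤ x
  u≥ p with ∈-map⁻ (2 + l +_) p
  ... | x , _ , refl = m≤m+n (2 + l) x

  v≤ : ∀ {x} → x ∈ v → x ≤ suc l
  v≤ p with ∈-map⁻ (skipOver l) p
  ... | x , x∈ , refl = ≤-trans (skipOver-≤ l x) (All.lookup b.bounded x∈)

  l∉v : l ∉ v
  l∉v p with ∈-map⁻ (skipOver l) p
  ... | x , _ , e = skipOver-≢ l x (sym e)

  u≻lv : u ≻ (l ∷ v)
  u≻lv p (here refl) = ≤-trans (n≤1+n _) (u≥ p)
  u≻lv p (there q)   = ≤-<-trans (v≤ q) (u≥ p)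

  u≻v : u ≻ v
  u≻v p q = u≻lv p (there q)

  l<n : 2 + l ≤ n
  l<n = subst (2 + l ≤_) eq (+-monoʳ-≤ 2 (m≤n+m l i))

  u<n : ∀ {x} → x ∈ u → x < n
  u<n p with ∈-map⁻ (2 + l +_) p
  ... | x , x∈ , refl = subst (2 + l + x <_) (trans (cong (suc ∘ suc) (+-comm l i)) eq)
                          (+-monoʳ-< (2 + l) (All.lookup a.bounded x∈))

  onlyAbove : OnlyAbove l (suc l) v
  onlyAbove = record
    { member = subst (_∈ v) (skipOver-self l) (∈-map⁺ (skipOver l) l∈b)
    ; above  = n<1+n l
    ; only   = λ z∈ l<z → ≤-antisym (v≤ z∈) l<z }
    where
    -- The value `l` is the maximum of `b`, which has length `suc l`; `skipOver l` lifts it to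
    -- `suc l`.
    l∈b : l ∈ b
    l∈b with Perm-split pb
    ... | u₀ , v₀ , refl , _ = ∈-++⁺ʳ u₀ (here refl)

  split : Split n (u ∷ʳ l) v
  split = record
    { u<n = All.++⁺ (All.tabulate u<n) (<-trans (n<1+n l) l<n ∷ [])
    ; v<n = All.tabulate (λ p → ≤-trans (s≤s (v≤ p)) l<n)
    ; uu = Unique.++⁺ (Unique.map⁺ (embedding-injective (shift-embedding (2 + l))) a.nodup) ([] ∷ [])
             λ { (p , here refl) → <-irrefl refl (u≻lv p (here refl)) }
    ; uv = Unique.map⁺ (embedding-injective (skipOver-embedding l)) b.nodup
    ; disj = disj
    ; total = begin
        length (u ∷ʳ l) + length v   ≡⟨ cong₂ _+_ (length-++ u) (trans (length-map (skipOver l) b) b.size) ⟩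
        length u + 1 + suc l         ≡⟨ cong (λ k → k + 1 + suc l) (trans (length-map (2 + l +_) a) a.size) ⟩
        i + 1 + suc l                ≡⟨ cong (_+ suc l) (+-comm i 1) ⟩
        suc i + suc l                ≡⟨ cong suc (+-suc i l) ⟩
        2 + i + l                    ≡⟨ eq ⟩
        n                            ∎ }
    where
    open ≡-Reasoning
    disj : ∀ {x} → x ∈ u ∷ʳ l → x ∉ v
    disj p q with ∈-++⁻ u p
    ... | inj₁ p′          = <-irrefl refl (u≻v p′ q)
    ... | inj₂ (here refl) = l∉v q

layer-class : ∀ {r c i j n ab} → i + j ≡ n → LayeredPair r c i j ab → Class (suc r) c (suc n) (layer n j ab)
layer-class {j = j} {n} {a , b} eq (layered pa ¬a pb ¬b cnt) = class (Perm-join split)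
  (λ p → [ ¬a ∘ Contains-map⁻ (shift-embedding j) a , ¬b ]′
           (Contains-max⁻ S.u<n S.v<n (≻⇒InitDominates u≻v) p))
  (trans (count132-++-max _ n b S.u<n S.v<n u≻v)
    (trans (cong (_+ count132 b) (count132-map (shift-embedding j) a)) cnt))
  where
  open Layer eq pa pb
  module S = Split split

cross-class : ∀ {r c i l n ab} → 2 + i + l ≡ n → CrossedPair r c i (suc l) ab →
              Class (suc r) c (suc n) (cross n l ab)
cross-class {r} {l = l} {n} {a , b} eq (crossed pa ¬a pb ¬b cnt) = class (Perm-join split)
  (λ p → [ AvoidsBeforeMin⁻ r u (All.tabulate (λ q → u≻lv q (here refl)))
             (AvoidsBeforeMin-map (shift-embedding (2 + l)) r a ¬a)
         , ¬b ∘ Contains-map⁻ (skipOver-embedding l) b ]′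
           (Contains-max⁻ S.u<n S.v<n (≻⇒InitDominates-∷ʳ l u≻v) p))
  (trans (cong count132 (∷ʳ-++ u l (n ∷ v)))
    (trans (count132-++-min-max u l (suc l) n v (All.tabulate u<n) S.v<n (<-trans (n<1+n l) l<n) S.uv u≻lv onlyAbove)
      (trans (cong suc (cong₂ _+_ (count132-map (shift-embedding (2 + l)) a) (count132-map (skipOver-embedding l) b))) cnt)))
  where
  open Cross eq pa pb
  module S = Split split

-- In a crossed word `n ∸ 2 ∸ i` is the value `l`: there are `i` entries and `l` on the left,
-- `suc l` entries on the right. The range `i < n ∸ 1` is empty for `n` at most 1 and otherwise
-- keeps the subtractions exact.
Layered Crossed : (r c n : ℕ) → List ℕ → Set
Layered r c n w = ∃ λ i → i < suc n × ∃ λ ab → LayeredPair r c i (n ∸ i) ab × w ≡ layer n (n ∸ i) ab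
Crossed r c n w = ∃ λ i → i < n ∸ 1 × ∃ λ ab → CrossedPair r c i (suc (n ∸ 2 ∸ i)) ab × w ≡ cross n (n ∸ 2 ∸ i) ab

mk-Layered : ∀ {r c i j n ab w} → i + j ≡ n → LayeredPair r c i j ab → w ≡ layer n j ab → Layered r c n w
mk-Layered {i = i} {j} refl p e = i , s≤s (m≤m+n i j) , _ ,
  subst (λ k → LayeredPair _ _ i k _) (sym (m+n∸m≡n i j)) p ,
  subst (λ k → _ ≡ layer (i + j) k _) (sym (m+n∸m≡n i j)) e

mk-Crossed : ∀ {r c i l n ab w} → 2 + i + l ≡ n → CrossedPair r c i (suc l) ab → w ≡ cross n l ab → Crossed r c n w
mk-Crossed {i = i} {l} refl p e = i , s≤s (m≤m+n i l) , _ ,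
  subst (λ k → CrossedPair _ _ i (suc k) _) (sym (m+n∸m≡n i l)) p ,
  subst (λ k → _ ≡ cross (2 + i + l) k _) (sym (m+n∸m≡n i l)) e

-- With `j` the length of `v`, an entry of `u` has `j` distinct values below it, so it is at least
-- `j`. An entry `y` of `v` leaves room for all of `u` strictly between `y` and `n`, so it is below
-- `j`.
unlayer : ∀ {r c n u v} → Split n u v → u ≻ v → Class (suc r) c (suc n) (u ++ n ∷ v) → Layered r c n (u ++ n ∷ v)
unlayer {r} {c} {n} {u} {v} s u≻v (class _ ¬c cnt) with preimage u inv
  where
  open Split s
  u≥ : ∀ {x} → x ∈ u → length v ≤ x
  u≥ {x} x∈ = Unique⇒length≤ z≤n uv (All.tabulate λ y∈ → z≤n , u≻v x∈ y∈)
  inv : ∀ {x} → x ∈ u → ∃ λ x₀ → length v + x₀ ≡ x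
  inv {x} x∈ = x ∸ length v , m+[n∸m]≡n (u≥ x∈)
... | a , refl = mk-Layered total (layered
    (Perm-preimage a refl uu λ {x} x∈ → +-cancelˡ-< j x _
      (subst (j + x <_) (trans (sym total) (+-comm (length (map (j +_) a)) j)) (All.lookup u<n (∈-map⁺ (j +_) x∈))))
    (λ p → ¬c (Contains-max v u<n (Contains-map (shift-embedding j) p)))
    (perm refl (All.tabulate v<j) uv)
    (λ p → ¬c (Contains-++ʳ (map (j +_) a) (there p)))
    (trans (cong (_+ count132 v) (sym (count132-map (shift-embedding j) a)))
      (trans (sym (count132-++-max _ n v u<n v<n u≻v)) cnt)))
  refl
  where
  open Split s
  j = length v
  v<j : ∀ {y} → y ∈ v → y < j
  v<j {y} y∈ = +-cancelʳ-≤ (length (map (j +_) a)) (suc y) j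
    (≤-trans (Unique⇒length≤ (All.lookup v<n y∈) uu (All.tabulate λ x∈ → u≻v x∈ y∈ , All.lookup u<n x∈))
      (≤-reflexive (trans (sym total) (+-comm (length (map (j +_) a)) j))))

-- The values are forced by squeezing. All of `u₁` lies strictly between `b` and `n`, so `b` is at
-- most the length of `v`; all of `v` except `b` lies below `a`, so that length is at most `suc a`.
-- As `a < b`, both equal `suc a`.
uncross : ∀ {r c n u₁ a b v} → Split n (u₁ ∷ʳ a) v → u₁ ≻ v → OnlyAbove a b v →
          Class (suc r) c (suc n) ((u₁ ∷ʳ a) ++ n ∷ v) → Crossed r c n ((u₁ ∷ʳ a) ++ n ∷ v)
uncross {r} {c} {n} {u₁} {a} {b} {v} s u≻v ab (class _ ¬c cnt) = go
  where
  open Split s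
  open OnlyAbove ab
  uu₁ = proj₁ (Unique-++⁻ u₁ uu)
  a∉v : a ∉ v
  a∉v = disj (∈-++⁺ʳ u₁ (here refl))
  u₁<n = All.++⁻ˡ u₁ u<n
  a<n : a < n
  a<n = All.lookup u<n (∈-++⁺ʳ u₁ (here refl))
  total′ : suc (length u₁) + length v ≡ n
  total′ = trans (cong (_+ length v) (trans (+-comm 1 (length u₁)) (sym (length-++ u₁)))) total
  b≤j : b ≤ length v
  b≤j = +-cancelʳ-≤ (suc (length u₁)) b (length v) (begin
    b + suc (length u₁) ≡⟨ +-suc b (length u₁) ⟩
    suc b + length u₁   ≤⟨ Unique⇒length≤ (All.lookup v<n member) uu₁
                             (All.tabulate λ x∈ → u≻v x∈ member , All.lookup u₁<n x∈) ⟩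
    n                   ≡⟨ total′ ⟨
    suc (length u₁) + length v ≡⟨ +-comm (suc (length u₁)) (length v) ⟩
    length v + suc (length u₁) ∎)
    where open ≤-Reasoning
  below : ∀ {z} → z ∈ v → z ∈ b ∷ upTo a
  below {z} z∈ with <-cmp a z
  ... | tri< a<z _ _  = here (only z∈ a<z)
  ... | tri≈ _ refl _ = ⊥-elim (a∉v z∈)
  ... | tri> _ _ z<a  = there (∈-upTo⁺ z<a)
  j≤1+a : length v ≤ suc a
  j≤1+a = ≤-trans (Unique⊆⇒length≤ uv below) (≤-reflexive (cong suc (length-upTo a)))
  j≡1+a : length v ≡ suc a
  j≡1+a = ≤-antisym j≤1+a (≤-trans above b≤j)
  b≡1+a : b ≡ suc a
  b≡1+a = ≤-antisym (≤-trans b≤j j≤1+a) above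
  u≻av : u₁ ≻ (a ∷ v)
  u≻av x∈ (here refl) = <-trans above (u≻v x∈ member)
  u≻av x∈ (there y∈)  = u≻v x∈ y∈
  total″ : 2 + length u₁ + a ≡ n
  total″ = trans (cong suc (sym (+-suc (length u₁) a))) (trans (cong (suc (length u₁) +_) (sym j≡1+a)) total′)
  inv₁ : ∀ {x} → x ∈ u₁ → ∃ λ x₀ → 2 + a + x₀ ≡ x
  inv₁ {x} x∈ = x ∸ (2 + a) , m+[n∸m]≡n (subst (λ k → suc k ≤ x) b≡1+a (u≻v x∈ member))
  inv₂ : ∀ {z} → z ∈ v → ∃ λ z₀ → skipOver a z₀ ≡ z
  inv₂ {z} z∈ = skipOver-surjective a z λ { refl → a∉v z∈ }
  v≤ : ∀ {z} → z ∈ v → z ≤ suc a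
  v≤ {z} z∈ with below z∈
  ... | here refl = ≤-reflexive b≡1+a
  ... | there p   = ≤-trans (<⇒≤ (∈-upTo⁻ p)) (n≤1+n a)
  count-eq : suc (count132 u₁ + count132 v) ≡ c
  count-eq = trans (sym (count132-++-min-max u₁ a b n v u₁<n v<n a<n uv u≻av ab))
    (trans (cong count132 (sym (∷ʳ-++ u₁ a (n ∷ v)))) cnt)
  avoid₁ : AvoidsBeforeMin r u₁
  avoid₁ = AvoidsBeforeMin⁺ r u₁ (All.tabulate λ x∈ → u≻av x∈ (here refl)) (¬c ∘ Contains-max v u<n)
  avoid₂ : ¬ Contains (suc r) v
  avoid₂ = ¬c ∘ Contains-++ʳ (u₁ ∷ʳ a) ∘ there
  go : Crossed r c n ((u₁ ∷ʳ a) ++ n ∷ v)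
  go with preimage u₁ inv₁ | preimage v inv₂
  ... | u₀ , eu | v₀ , ev = mk-Crossed {ab = u₀ , v₀} total″ (crossed
      (Perm-preimage u₀ (cong length (sym eu)) (subst Unique eu uu₁) λ {x} x∈ → +-cancelˡ-< (2 + a) x _
        (subst (2 + a + x <_) (trans (sym total″) (cong (2 +_) (+-comm (length u₁) a)))
          (All.lookup u₁<n (subst (_ ∈_) (sym eu) (∈-map⁺ (2 + a +_) x∈)))))
      (AvoidsBeforeMin-map⁻ (shift-embedding (2 + a)) r u₀ (subst (AvoidsBeforeMin r) eu avoid₁))
      (Perm-preimage v₀ (trans (cong length (sym ev)) j≡1+a) (subst Unique ev uv) λ {x} x∈ →
        s≤s (skipOver-bounded⁻ a x (v≤ (subst (_ ∈_) (sym ev) (∈-map⁺ (skipOver a) x∈)))))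
      (λ p → avoid₂ (subst (Contains (suc r)) (sym ev) (Contains-map (skipOver-embedding a) p)))
      (trans (cong suc (cong₂ _+_
        (trans (sym (count132-map (shift-embedding (2 + a)) u₀)) (cong count132 (sym eu)))
        (trans (sym (count132-map (skipOver-embedding a) v₀)) (cong count132 (sym ev))))) count-eq))
    (cong₂ (λ x y → (x ∷ʳ a) ++ n ∷ y) eu ev)

decompose : ∀ {r c n} → c ≤ 1 → (λ w → Layered r c n w ⊎ Crossed r c n w) ⇔ Class (suc r) c (suc n)
decompose {r} {c} {n} c≤1 {w} = to , from
  where
  to : Layered r c n w ⊎ Crossed r c n w → Class (suc r) c (suc n) w
  to (inj₁ (i , s≤s i≤n , ab , p , refl)) = layer-class (m+[n∸m]≡n i≤n) p
  to (inj₂ (i , i<n , ab , p , refl))     = cross-class (index n i<n) p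
    where
    index : ∀ n → i < n ∸ 1 → 2 + i + (n ∸ 2 ∸ i) ≡ n
    index (suc (suc n)) (s≤s i≤n) = cong (2 +_) (m+[n∸m]≡n i≤n)
  from : Class (suc r) c (suc n) w → Layered r c n w ⊎ Crossed r c n w
  from cl with Perm-split (Class.isPerm cl)
  ... | u , v , refl , s with shape u n v (Split.v<n s) (Split.disj s) (≤-trans (≤-reflexive (Class.count cl)) c≤1)
  ...   | dominating u≻v                  = inj₁ (unlayer s u≻v cl)
  ...   | one-exception u₁ a b refl u≻v ab = inj₂ (uncross s u≻v ab cl)

class-0 : ∀ {r c} → (λ w → w ≡ [] × 0 ≡ c) ⇔ Class r c 0
class-0 {r} {c} = to , from _
  where
  to : ∀ {w} → w ≡ [] × 0 ≡ c → Class r c 0 w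
  to (refl , e) = class (perm refl [] []) (λ ()) e
  from : ∀ w → Class r c 0 w → w ≡ [] × 0 ≡ c
  from [] (class _ _ e) = refl , e

-- Avoiding 21 forces the maximum to stand last.
increasing-class : ∀ {c n} → (λ w → ∃ λ u → Class 0 c n u × w ≡ u ∷ʳ n) ⇔ Class 0 c (suc n)
increasing-class {c} {n} {w} = to , from
  where
  count-∷ʳ : ∀ u → All (_< n) u → count132 (u ∷ʳ n) ≡ count132 u
  count-∷ʳ u u<n = trans (count132-++-max u n [] u<n [] (λ _ ())) (+-identityʳ (count132 u))
  Contains-∷ʳ⁻ : ∀ u → All (_< n) u → Contains 0 (u ∷ʳ n) → Contains 0 u
  Contains-∷ʳ⁻ []          _         (there ())
  Contains-∷ʳ⁻ (x ∷ [])    (x<n ∷ _) (here n<x _) = ⊥-elim (<⇒≱ n<x (<⇒≤ x<n))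
  Contains-∷ʳ⁻ (x ∷ [])    _         (there (there ()))
  Contains-∷ʳ⁻ (x ∷ y ∷ u) _         (here l _)   = here l stop
  Contains-∷ʳ⁻ (x ∷ y ∷ u) (_ ∷ u<n) (there p)    = there (Contains-∷ʳ⁻ (y ∷ u) u<n p)
  to : (∃ λ u → Class 0 c n u × w ≡ u ∷ʳ n) → Class 0 c (suc n) w
  to (u , class (perm size bd uu) ¬c e , refl) = class
    (Perm-join (record
      { u<n = bd ; v<n = [] ; uu = uu ; uv = [] ; disj = λ _ () ; total = trans (+-identityʳ (length u)) size }))
    (¬c ∘ Contains-∷ʳ⁻ u bd)
    (trans (count-∷ʳ u bd) e)
  from : Class 0 c (suc n) w → ∃ λ u → Class 0 c n u × w ≡ u ∷ʳ n
  from (class p ¬c e) with Perm-split p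
  ... | u , [] , refl , s = u , class
      (perm (trans (sym (+-identityʳ (length u))) total) u<n uu)
      (¬c ∘ Contains-++ˡ (n ∷ []))
      (trans (sym (count-∷ʳ u u<n)) e)
    , refl
    where open Split s
  ... | u , y ∷ v , refl , s = ⊥-elim (¬c (Contains-++ʳ u (here (All.head (Split.v<n s)) stop)))

-- Uniqueness of the decomposition and the resulting enumeration

-- The left factor for total count 1: the crossing already supplies the single 132, so none is left
-- for `a`.
LeftOfCross : ℕ → ℕ → List ℕ → Set
LeftOfCross r i a = Perm i a × AvoidsBeforeMin r a × count132 a ≡ 0

layer-injective : ∀ {r c i j n x y} → i + j ≡ n → LayeredPair r c i j x → LayeredPair r c i j y →
                  layer n j x ≡ layer n j y → x ≡ y
layer-injective {j = j} {n} {a , b} {a′ , b′} eq p q e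
  with ∷-split-injective (map (j +_) a) (map (j +_) a′) (<-irrefl refl ∘ P.u<n) (<-irrefl refl ∘ Q.u<n) e
  where
  module P = Layer eq (LayeredPair.permˡ p) (LayeredPair.permʳ p)
  module Q = Layer eq (LayeredPair.permˡ q) (LayeredPair.permʳ q)
... | e₁ , e₂ = cong₂ _,_ (map-injective (+-cancelˡ-≡ j _ _) e₁) e₂

layer-index : ∀ {r c i j i′ j′ n x y} → i + j ≡ n → i′ + j′ ≡ n → LayeredPair r c i j x → LayeredPair r c i′ j′ y →
              layer n j x ≡ layer n j′ y → i ≡ i′
layer-index {i = i} {j} {i′} {j′} {n} {a , b} {a′ , b′} eq eq′ p q e
  with ∷-split-injective (map (j +_) a) (map (j′ +_) a′) (<-irrefl refl ∘ P.u<n) (<-irrefl refl ∘ Q.u<n) e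
  where
  module P = Layer eq (LayeredPair.permˡ p) (LayeredPair.permʳ p)
  module Q = Layer eq′ (LayeredPair.permˡ q) (LayeredPair.permʳ q)
... | e₁ , _ = begin
  i                       ≡⟨ Perm.size (LayeredPair.permˡ p) ⟨
  length a                ≡⟨ length-map (j +_) a ⟨
  length (map (j +_) a)   ≡⟨ cong length e₁ ⟩
  length (map (j′ +_) a′) ≡⟨ length-map (j′ +_) a′ ⟩
  length a′               ≡⟨ Perm.size (LayeredPair.permˡ q) ⟩
  i′                      ∎
  where open ≡-Reasoning

cross-split : ∀ {r c i l i′ l′ n x y} → 2 + i + l ≡ n → 2 + i′ + l′ ≡ n →
              CrossedPair r c i (suc l) x → CrossedPair r c i′ (suc l′) y → cross n l x ≡ cross n l′ y →
              map (2 + l +_) (proj₁ x) ∷ʳ l ≡ map (2 + l′ +_) (proj₁ y) ∷ʳ l′ ×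
              map (skipOver l) (proj₂ x) ≡ map (skipOver l′) (proj₂ y)
cross-split eq eq′ p q e = ∷-split-injective _ _
  (<-irrefl refl ∘ All.lookup (Split.u<n P.split)) (<-irrefl refl ∘ All.lookup (Split.u<n Q.split)) e
  where
  module P = Cross eq (CrossedPair.permˡ p) (CrossedPair.permʳ p)
  module Q = Cross eq′ (CrossedPair.permˡ q) (CrossedPair.permʳ q)

cross-injective : ∀ {r c i l n x y} → 2 + i + l ≡ n → CrossedPair r c i (suc l) x → CrossedPair r c i (suc l) y →
                  cross n l x ≡ cross n l y → x ≡ y
cross-injective {l = l} {x = x} {y} eq p q e with cross-split eq eq p q e
... | e₁ , e₂ = cong₂ _,_
  (map-injective (+-cancelˡ-≡ (2 + l) _ _) (∷ʳ-injectiveˡ _ _ e₁))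
  (map-injective (embedding-injective (skipOver-embedding l)) e₂)

cross-index : ∀ {r c i l i′ l′ n x y} → 2 + i + l ≡ n → 2 + i′ + l′ ≡ n →
              CrossedPair r c i (suc l) x → CrossedPair r c i′ (suc l′) y → cross n l x ≡ cross n l′ y → i ≡ i′
cross-index {i = i} {l} {i′} {l′} {x = a , b} {a′ , b′} eq eq′ p q e with cross-split eq eq′ p q e
... | e₁ , _ = begin
  i                            ≡⟨ Perm.size (CrossedPair.permˡ p) ⟨
  length a                     ≡⟨ length-map (2 + l +_) a ⟨
  length (map (2 + l +_) a)    ≡⟨ cong length (∷ʳ-injectiveˡ _ (map (2 + l′ +_) a′)
                                    (trans e₁ (cong (map (2 + l′ +_) a′ ∷ʳ_) (sym (∷ʳ-injectiveʳ _ _ e₁))))) ⟩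
  length (map (2 + l′ +_) a′)  ≡⟨ length-map (2 + l′ +_) a′ ⟩
  length a′                    ≡⟨ Perm.size (CrossedPair.permˡ q) ⟩
  i′                           ∎
  where open ≡-Reasoning

-- A crossed word has `l` before `n` and `suc l` after it, while in a layered word everything before
-- `n` exceeds everything after it.
layer≢cross : ∀ {r c i j i′ l n x y} → i + j ≡ n → 2 + i′ + l ≡ n →
              LayeredPair r c i j x → CrossedPair r c i′ (suc l) y → layer n j x ≢ cross n l y
layer≢cross {j = j} {l = l} {x = a , b} {a′ , b′} eq eq′ p q e
  with ∷-split-injective (map (j +_) a) (Q.u ∷ʳ l) (<-irrefl refl ∘ P.u<n)
         (<-irrefl refl ∘ All.lookup (Split.u<n Q.split)) e
  where
  module P = Layer eq (LayeredPair.permˡ p) (LayeredPair.permʳ p)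
  module Q = Cross eq′ (CrossedPair.permˡ q) (CrossedPair.permʳ q)
... | e₁ , e₂ = <-asym (n<1+n l) (P.u≻v (subst (l ∈_) (sym e₁) (∈-++⁺ʳ Q.u (here refl)))
                                        (subst (suc l ∈_) (sym e₂) (OnlyAbove.member Q.onlyAbove)))
  where
  module P = Layer eq (LayeredPair.permˡ p) (LayeredPair.permʳ p)
  module Q = Cross eq′ (CrossedPair.permˡ q) (CrossedPair.permʳ q)

layer-total : ∀ {i n} → i < suc n → i + (n ∸ i) ≡ n
layer-total (s≤s i≤n) = m+[n∸m]≡n i≤n

cross-total : ∀ {i} n → i < n ∸ 1 → 2 + i + (n ∸ 2 ∸ i) ≡ n
cross-total (suc (suc n)) (s≤s i≤n) = cong (2 +_) (m+[n∸m]≡n i≤n)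

Enum-Layered : ∀ {r c n} {N : ℕ → ℕ} → (∀ i → Enum (LayeredPair r c i (n ∸ i)) (N i)) →
               Enum (Layered r c n) (Σ< (suc n) N)
Enum-Layered {r} {c} {n} e = Enum-⋃ (suc n)
  (λ { i< i′< (_ , p , refl) (_ , q , eq) → layer-index (layer-total i<) (layer-total i′<) p q eq })
  (λ i i< → Enum-image (layer n (n ∸ i)) (layer-injective (layer-total i<)) (e i))

Enum-Crossed : ∀ {r c n} {N : ℕ → ℕ} → (∀ i → Enum (CrossedPair r c i (suc (n ∸ 2 ∸ i))) (N i)) →
               Enum (Crossed r c n) (Σ< (n ∸ 1) N)
Enum-Crossed {r} {c} {n} e = Enum-⋃ (n ∸ 1)
  (λ { i< i′< (_ , p , refl) (_ , q , eq) → cross-index (cross-total n i<) (cross-total n i′<) p q eq })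
  (λ i i< → Enum-image (cross n (n ∸ 2 ∸ i)) (cross-injective (cross-total n i<)) (e i))

Enum-Class-suc : ∀ {r c n} {M N : ℕ → ℕ} → c ≤ 1 →
                 (∀ i → Enum (LayeredPair r c i (n ∸ i)) (M i)) →
                 (∀ i → Enum (CrossedPair r c i (suc (n ∸ 2 ∸ i))) (N i)) →
                 Enum (Class (suc r) c (suc n)) (Σ< (suc n) M + Σ< (n ∸ 1) N)
Enum-Class-suc {n = n} c≤1 e e′ = Enum-cong (decompose c≤1)
  (Enum-⊎ (λ { (i , i< , _ , p , refl) (i′ , i′< , _ , q , eq) →
               layer≢cross (layer-total i<) (cross-total n i′<) p q eq })
          (Enum-Layered e) (Enum-Crossed e′))

-- Recurrences for the counts

Σ<-0 : ∀ N → Σ< N (λ _ → 0) ≡ 0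
Σ<-0 zero    = refl
Σ<-0 (suc N) = Σ<-0 N

-- The counting function stays abstract: the recurrences follow from the enumerations alone,
-- whatever Boolean test produces them.
module Recurrences (N : ℕ → ℕ → ℕ → ℕ) (enumClass : ∀ r c n → Enum (Class r c n) (N r c n)) where

  -- The coefficients of G_{r+2}: for `r = 0` only the empty word qualifies, so the series is 1.
  leftOfCross# : ℕ → ℕ → ℕ
  leftOfCross# zero    zero    = 1
  leftOfCross# zero    (suc _) = 0
  leftOfCross# (suc r) i       = N (suc r) 0 i

  Enum-LeftOfCross : ∀ r i → Enum (LeftOfCross r i) (leftOfCross# r i)
  Enum-LeftOfCross zero zero    = Enum-cong
    ((λ { refl → perm refl [] [] , refl , refl }) , λ (_ , e , _) → e) (Enum-singleton [])
  Enum-LeftOfCross zero (suc i) = Enum-⊥ λ { (perm () _ _ , refl , _) }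
  Enum-LeftOfCross (suc r) i    = Enum-cong
    ((λ (class p ¬c e) → p , ¬c , e) , λ (p , ¬c , e) → class p ¬c e) (enumClass (suc r) 0 i)

  Class-0-0 : ∀ r → N r 0 0 ≡ 1
  Class-0-0 r = Enum-size (enumClass r 0 0) (Enum-singleton [])
    ((λ p → proj₁ (proj₂ class-0 p)) , (λ e → proj₁ class-0 (e , refl)))

  Class-1-0 : ∀ r → N r 1 0 ≡ 0
  Class-1-0 r = Enum-size (enumClass r 1 0) (Enum-⊥ {P = λ _ → ⊥} λ ())
    ((λ p → contradiction (proj₂ (proj₂ class-0 p)) λ ()) , λ ())

  increasing-suc : ∀ c n → N 0 c (suc n) ≡ N 0 c n
  increasing-suc c n = Enum-size (enumClass 0 c (suc n))
    (Enum-image (_∷ʳ n) (λ _ _ → ∷ʳ-injectiveˡ _ _) (enumClass 0 c n))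
    (proj₂ increasing-class , proj₁ increasing-class)

  increasing-0 : ∀ n → N 0 0 n ≡ 1
  increasing-0 zero    = Class-0-0 0
  increasing-0 (suc n) = trans (increasing-suc 0 n) (increasing-0 n)

  increasing-1 : ∀ n → N 0 1 n ≡ 0
  increasing-1 zero    = Class-1-0 0
  increasing-1 (suc n) = trans (increasing-suc 1 n) (increasing-1 n)

  avoiding-suc : ∀ r n → N (suc r) 0 (suc n) ≡ Σ< (suc n) (λ i → N r 0 i * N (suc r) 0 (n ∸ i))
  avoiding-suc r n = trans
    (Enum-size (enumClass (suc r) 0 (suc n))
      (Enum-Class-suc z≤n (λ i → Enum-cong pair⇔ (Enum-× (enumClass r 0 i) (enumClass (suc r) 0 (n ∸ i))))
                          -- A crossed word has at least one 132, so this half is empty at count 0.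
                          (λ i → Enum-⊥ λ p → 1+n≢0 (CrossedPair.count p)))
      ((λ z → z) , (λ z → z)))
    (trans (cong (Σ< (suc n) (λ i → N r 0 i * N (suc r) 0 (n ∸ i)) +_) (Σ<-0 (n ∸ 1))) (+-identityʳ _))
    where
    pair⇔ : ∀ {i j} → (λ (a , b) → Class r 0 i a × Class (suc r) 0 j b) ⇔ LayeredPair r 0 i j
    pair⇔ = (λ (class p ¬c e , class p′ ¬c′ e′) → layered p ¬c p′ ¬c′ (cong₂ _+_ e e′))
          , (λ (layered p ¬c p′ ¬c′ e) → class p ¬c (m+n≡0⇒m≡0 _ e) , class p′ ¬c′ (m+n≡0⇒n≡0 _ e))

  containing-suc : ∀ r n → N (suc r) 1 (suc n) ≡
    Σ< (suc n) (λ i → N r 1 i * N (suc r) 0 (n ∸ i) + N r 0 i * N (suc r) 1 (n ∸ i))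
    -- The right factor has positive length, since it carries the value `l + 1`; this sum is a
    -- coefficient of G (F - 1).
    + Σ< (n ∸ 1) (λ i → leftOfCross# r i * N (suc r) 0 (suc (n ∸ 2 ∸ i)))
  containing-suc r n = Enum-size (enumClass (suc r) 1 (suc n))
    (Enum-Class-suc ≤-refl
      (λ i → Enum-cong layered⇔ (Enum-⊎
        (λ (p , _) (q , _) → 1+n≢0 (trans (sym (Class.count p)) (Class.count q)))
        (Enum-× (enumClass r 1 i) (enumClass (suc r) 0 (n ∸ i)))
        (Enum-× (enumClass r 0 i) (enumClass (suc r) 1 (n ∸ i)))))
      (λ i → Enum-cong crossed⇔ (Enum-× (Enum-LeftOfCross r i) (enumClass (suc r) 0 (suc (n ∸ 2 ∸ i))))))
    ((λ z → z) , (λ z → z))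
    where
    layered⇔ : ∀ {i j} → (λ (a , b) → Class r 1 i a × Class (suc r) 0 j b ⊎ Class r 0 i a × Class (suc r) 1 j b)
                         ⇔ LayeredPair r 1 i j
    layered⇔ {i} {j} {a , b} = to , from
      where
      to : Class r 1 i a × Class (suc r) 0 j b ⊎ Class r 0 i a × Class (suc r) 1 j b → LayeredPair r 1 i j (a , b)
      to (inj₁ (class p ¬c e , class p′ ¬c′ e′)) = layered p ¬c p′ ¬c′ (cong₂ _+_ e e′)
      to (inj₂ (class p ¬c e , class p′ ¬c′ e′)) = layered p ¬c p′ ¬c′ (cong₂ _+_ e e′)
      from : LayeredPair r 1 i j (a , b) → Class r 1 i a × Class (suc r) 0 j b ⊎ Class r 0 i a × Class (suc r) 1 j b
      from (layered p ¬c p′ ¬c′ e) with count132 a in ea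
      ... | zero       = inj₂ (class p ¬c ea , class p′ ¬c′ e)
      ... | suc zero   = inj₁ (class p ¬c ea , class p′ ¬c′ (suc-injective e))
      ... | suc (suc _) = contradiction (suc-injective e) λ ()
    crossed⇔ : ∀ {i j} → (λ (a , b) → LeftOfCross r i a × Class (suc r) 0 j b) ⇔ CrossedPair r 1 i j
    crossed⇔ = (λ ((p , av , e) , class p′ ¬c′ e′) → crossed p av p′ ¬c′ (cong suc (cong₂ _+_ e e′)))
             , (λ (crossed p av p′ ¬c′ e) → (p , av , m+n≡0⇒m≡0 _ (suc-injective e))
                                          , class p′ ¬c′ (m+n≡0⇒n≡0 _ (suc-injective e)))

-- Reflection of the Boolean definitions

Bool-ext : ∀ {a b} → (a ≡ true → b ≡ true) → (b ≡ true → a ≡ true) → a ≡ b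
Bool-ext {false} {false} f g = refl
Bool-ext {false} {true}  f g = g refl
Bool-ext {true}          f g = sym (f refl)

==ᵇ-refl : ∀ {a b} → a ≡ b → (a ==ᵇ b) ≡ true
==ᵇ-refl {false} refl = refl
==ᵇ-refl {true}  refl = refl

==ᵇ⇒≡ : ∀ {a b} → (a ==ᵇ b) ≡ true → a ≡ b
==ᵇ⇒≡ {false} {false} _  = refl
==ᵇ⇒≡ {true}          eq = sym eq

≡ᵇ-true : ∀ {m n} → m ≡ n → (m ≡ᵇ n) ≡ true
≡ᵇ-true {zero}  refl = refl
≡ᵇ-true {suc m} refl = ≡ᵇ-true {m} refl

≡ᵇ-true⁻ : ∀ {m n} → (m ≡ᵇ n) ≡ true → m ≡ n
≡ᵇ-true⁻ {m} {n} eq = ≡ᵇ⇒≡ m n (subst T (sym eq) _)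

module _ {A : Set} where

  filterB-⊆ : (p : A → Bool) (xs : List A) {x : A} → x ∈ filterB p xs → x ∈ xs × p x ≡ true
  filterB-⊆ p (y ∷ xs) x∈ with p y in py
  filterB-⊆ p (y ∷ xs) (here refl) | true  = here refl , py
  filterB-⊆ p (y ∷ xs) (there x∈)  | true  = let q , px = filterB-⊆ p xs x∈ in there q , px
  filterB-⊆ p (y ∷ xs) x∈          | false = let q , px = filterB-⊆ p xs x∈ in there q , px

  ∈-filterB : (p : A → Bool) {xs : List A} {x : A} → x ∈ xs → p x ≡ true → x ∈ filterB p xs
  ∈-filterB p (here refl) px rewrite px = here refl
  ∈-filterB p {y ∷ xs} (there x∈) px with p y
  ... | true  = there (∈-filterB p x∈ px)
  ... | false = ∈-filterB p x∈ px

  Unique-filterB : (p : A → Bool) {xs : List A} → Unique xs → Unique (filterB p xs)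
  Unique-filterB p []                    = []
  Unique-filterB p {x ∷ xs} (x≢ ∷ u) with p x
  ... | true  = All.tabulate (λ q → All.lookup x≢ (proj₁ (filterB-⊆ p xs q))) ∷ Unique-filterB p u
  ... | false = Unique-filterB p u

  length-filterB : (p : A → Bool) (xs : List A) → length (filterB p xs) ≡ countB p xs
  length-filterB p []       = refl
  length-filterB p (x ∷ xs) with p x
  ... | true  = cong suc (length-filterB p xs)
  ... | false = length-filterB p xs

  countB-filterB : (p q : A → Bool) (xs : List A) → countB p (filterB q xs) ≡ countB (λ x → q x ∧ p x) xs
  countB-filterB p q []       = refl
  countB-filterB p q (x ∷ xs) with q x
  ... | false = countB-filterB p q xs
  ... | true with p x
  ...   | true  = cong suc (countB-filterB p q xs)
  ...   | false = countB-filterB p q xs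

  allB⁻ : {p : A → Bool} {xs : List A} {x : A} → allB p xs ≡ true → x ∈ xs → p x ≡ true
  allB⁻ {p} {y ∷ xs} eq (here refl) = proj₁ (∧-true⁻ eq)
  allB⁻ {p} {y ∷ xs} eq (there x∈)  = allB⁻ (proj₂ (∧-true⁻ {p y} eq)) x∈

  allB⁺ : {p : A → Bool} (xs : List A) → (∀ {x} → x ∈ xs → p x ≡ true) → allB p xs ≡ true
  allB⁺ []       _  = refl
  allB⁺ (y ∷ xs) px = ∧-true (px (here refl)) (allB⁺ xs (px ∘ there))

words-product : ∀ m n → words m (suc n) ≡ cartesianProductWith _∷_ (upTo m) (words m n)
words-product m n = go (upTo m)
  where
  go : ∀ xs → concatMap (λ a → map (a ∷_) (words m n)) xs ≡ cartesianProductWith _∷_ xs (words m n)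
  go []       = refl
  go (x ∷ xs) = cong (map (x ∷_) (words m n) ++_) (go xs)

Unique-words : ∀ m n → Unique (words m n)
Unique-words m zero    = [] ∷ []
Unique-words m (suc n) = subst Unique (sym (words-product m n))
  (Unique.cartesianProductWith⁺ _∷_ ∷-injective (Unique.upTo⁺ m) (Unique-words m n))

∈-words⁺ : ∀ {m n w} → length w ≡ n → All (_< m) w → w ∈ words m n
∈-words⁺ {n = zero} refl []            = here refl
∈-words⁺ {m} {suc n} size (a< ∷ w<) = subst (_ ∈_) (sym (words-product m n))
  (∈-cartesianProductWith⁺ _∷_ (∈-upTo⁺ a<) (∈-words⁺ (suc-injective size) w<))

∈-words⁻ : ∀ {m} n {w} → w ∈ words m n → length w ≡ n × All (_< m) w
∈-words⁻     zero    (here refl) = refl , []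
∈-words⁻ {m} (suc n) w∈
  with ∈-cartesianProductWith⁻ _∷_ (upTo m) (words m n) (subst (_ ∈_) (words-product m n) w∈)
... | a , w , a∈ , w∈′ , refl = let size , w< = ∈-words⁻ n w∈′ in cong suc size , ∈-upTo⁻ a∈ ∷ w<

anyB-false : ∀ {a} w → All (a ≢_) w → anyB (a ≡ᵇ_) w ≡ false
anyB-false         []      []        = refl
anyB-false {a} (b ∷ w) (a≢b ∷ a≢) with a ≡ᵇ b in ab
... | true  = ⊥-elim (a≢b (≡ᵇ-true⁻ ab))
... | false = anyB-false w a≢

anyB-false⁻ : ∀ {a} w → anyB (a ≡ᵇ_) w ≡ false → All (a ≢_) w
anyB-false⁻     []      _  = []
anyB-false⁻ {a} (b ∷ w) eq with a ≡ᵇ b in ab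
... | false = (λ e → contradiction (trans (sym ab) (≡ᵇ-true e)) λ ()) ∷ anyB-false⁻ w eq

distinct⁺ : ∀ {w} → Unique w → distinct w ≡ true
distinct⁺ []               = refl
distinct⁺ {a ∷ w} (a≢ ∷ u) rewrite anyB-false w a≢ = distinct⁺ u

distinct⁻ : ∀ w → distinct w ≡ true → Unique w
distinct⁻ []      _  = []
distinct⁻ (a ∷ w) eq with anyB (a ≡ᵇ_) w in aw
... | false = anyB-false⁻ w aw ∷ distinct⁻ w eq

∈-perms⁺ : ∀ {n w} → Perm n w → w ∈ perms n
∈-perms⁺ (perm size bd u) = ∈-filterB distinct (∈-words⁺ size bd) (distinct⁺ u)

∈-perms⁻ : ∀ {n w} → w ∈ perms n → Perm n w
∈-perms⁻ {n} {w} w∈ with filterB-⊆ distinct (words n n) w∈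
... | w∈′ , d = let size , bd = ∈-words⁻ n w∈′ in perm size bd (distinct⁻ w d)

-- Occurrences of 1-3-2

indicator : Bool → ℕ
indicator b = if b then 1 else 0

Σ<-cong : ∀ {f g : ℕ → ℕ} N → (∀ i → f i ≡ g i) → Σ< N f ≡ Σ< N g
Σ<-cong zero    eq = refl
Σ<-cong (suc N) eq = cong₂ _+_ (eq 0) (Σ<-cong N (eq ∘ suc))

countB-concatMap : {A : Set} (p : A → Bool) (g : ℕ → List A) (f : ℕ → ℕ) (m : ℕ) →
                   countB p (concatMap g (applyUpTo f m)) ≡ Σ< m (λ i → countB p (g (f i)))
countB-concatMap p g f zero    = refl
countB-concatMap p g f (suc m) = trans (countB-++ p (g (f 0)) _)
  (cong (countB p (g (f 0)) +_) (countB-concatMap p g (f ∘ suc) m))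

countB-words : ∀ (p : List ℕ → Bool) m n →
               countB p (words m (suc n)) ≡ Σ< m (λ a → countB (p ∘ (a ∷_)) (words m n))
countB-words p m n = trans (countB-concatMap p _ id m) (Σ<-cong m λ a → countB-map p (a ∷_) (words m n))

countB-words-3 : ∀ (p : List ℕ → Bool) m →
  countB p (words m 3) ≡ Σ< m (λ i → Σ< m (λ j → Σ< m (λ l → indicator (p (i ∷ j ∷ l ∷ [])))))
countB-words-3 p m = trans (countB-words p m 2) (Σ<-cong m λ i →
  trans (countB-words _ m 1) (Σ<-cong m λ j → trans (countB-words _ m 0) (Σ<-cong m λ l → refl)))

Σ<-nth : ∀ (P : ℕ → Bool) w → Σ< (length w) (λ l → indicator (P (nth w l))) ≡ countB P w
Σ<-nth P []      = refl
Σ<-nth P (z ∷ w) with P z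
... | true  = cong suc (Σ<-nth P w)
... | false = Σ<-nth P w

-- Splitting index 0 off both sums: the terms with `l = 0` vanish by computation, `j = 0` makes `y`
-- the letter 3, and the remaining terms are the sum for `w`.
Σ<-count132From : ∀ x w →
  Σ< (length w) (λ j → Σ< (length w) (λ l →
    indicator ((j <ᵇ l) ∧ ((x <ᵇ nth w l) ∧ (nth w l <ᵇ nth w j))))) ≡ count132From x w
Σ<-count132From x []      = refl
Σ<-count132From x (y ∷ w) = cong₂ _+_ (Σ<-nth (λ z → (x <ᵇ z) ∧ (z <ᵇ y)) w) (Σ<-count132From x w)

-- The test `j <ᵇ l` stands first so that a term with `l = 0` reduces to 0 by computation even when
-- the comparison of `i` with `j` is stuck. The terms with `i = 0` then give the occurrences
-- starting at `x`.
Σ<-count132 : ∀ w →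
  Σ< (length w) (λ i → Σ< (length w) (λ j → Σ< (length w) (λ l →
    indicator ((j <ᵇ l) ∧ ((i <ᵇ j) ∧ ((nth w i <ᵇ nth w l) ∧ (nth w l <ᵇ nth w j))))))) ≡ count132 w
Σ<-count132 []      = refl
Σ<-count132 (x ∷ w) = cong₂ _+_
  (cong₂ _+_ (Σ<-0 (length w)) (Σ<-count132From x w))
  (trans (Σ<-cong (length w) λ i → cong₂ _+_ (Σ<-0 (length w)) refl) (Σ<-count132 w))

orderIso⁺ : ∀ τ π is →
  (∀ a b → a < length τ → b < length τ → (nth τ a <ᵇ nth τ b) ≡ (nth π (nth is a) <ᵇ nth π (nth is b))) →
  orderIso τ π is ≡ true
orderIso⁺ τ π is o = allB⁺ _ λ a∈ → allB⁺ _ λ b∈ → ==ᵇ-refl (o _ _ (∈-upTo⁻ a∈) (∈-upTo⁻ b∈))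

orderIso⁻ : ∀ τ π is → orderIso τ π is ≡ true →
  ∀ a b → a < length τ → b < length τ → (nth τ a <ᵇ nth τ b) ≡ (nth π (nth is a) <ᵇ nth π (nth is b))
orderIso⁻ τ π is eq a b a< b< = ==ᵇ⇒≡ (allB⁻ (allB⁻ eq (∈-upTo⁺ a<)) (∈-upTo⁺ b<))

orderIso-132 : ∀ π i j l → orderIso (letters p1-3-2) π (i ∷ j ∷ l ∷ []) ≡
               (nth π i <ᵇ nth π l) ∧ (nth π l <ᵇ nth π j)
orderIso-132 π i j l = Bool-ext to from
  where
  τ = letters p1-3-2
  is = i ∷ j ∷ l ∷ []
  to : orderIso τ π is ≡ true → (nth π i <ᵇ nth π l) ∧ (nth π l <ᵇ nth π j) ≡ true
  to eq = ∧-true (sym (orderIso⁻ τ π is eq 0 2 (s≤s z≤n) (s≤s (s≤s (s≤s z≤n)))))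
                 (sym (orderIso⁻ τ π is eq 2 1 (s≤s (s≤s (s≤s z≤n))) (s≤s (s≤s z≤n))))
  from : (nth π i <ᵇ nth π l) ∧ (nth π l <ᵇ nth π j) ≡ true → orderIso τ π is ≡ true
  from eq = orderIso⁺ τ π is o
    where
    i<l : nth π i < nth π l
    i<l = <ᵇ-true⁻ (proj₁ (∧-true⁻ eq))
    l<j : nth π l < nth π j
    l<j = <ᵇ-true⁻ (proj₂ (∧-true⁻ {nth π i <ᵇ nth π l} eq))
    i<j : nth π i < nth π j
    i<j = <-trans i<l l<j
    o : ∀ a b → a < 3 → b < 3 → (nth τ a <ᵇ nth τ b) ≡ (nth π (nth is a) <ᵇ nth π (nth is b))
    o 0 0 _ _ = sym (<ᵇ-false (≤-refl {nth π i}))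
    o 0 1 _ _ = sym (<ᵇ-true i<j)
    o 0 2 _ _ = sym (<ᵇ-true i<l)
    o 1 0 _ _ = sym (<ᵇ-false (<⇒≤ i<j))
    o 1 1 _ _ = sym (<ᵇ-false (≤-refl {nth π j}))
    o 1 2 _ _ = sym (<ᵇ-false (<⇒≤ l<j))
    o 2 0 _ _ = sym (<ᵇ-false (<⇒≤ i<l))
    o 2 1 _ _ = sym (<ᵇ-true l<j)
    o 2 2 _ _ = sym (<ᵇ-false (≤-refl {nth π l}))
    o (suc (suc (suc _))) _ (s≤s (s≤s (s≤s ()))) _
    o 0 (suc (suc (suc _))) _ (s≤s (s≤s (s≤s ())))
    o 1 (suc (suc (suc _))) _ (s≤s (s≤s (s≤s ())))
    o 2 (suc (suc (suc _))) _ (s≤s (s≤s (s≤s ())))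

occurrences-132 : ∀ π → occurrences p1-3-2 π ≡ count132 π
occurrences-132 π = begin
  occurrences p1-3-2 π
    ≡⟨ countB-filterB (isOccurrence p1-3-2 π) strictlyIncreasing (words n 3) ⟩
  countB (λ is → strictlyIncreasing is ∧ isOccurrence p1-3-2 π is) (words n 3)
    ≡⟨ countB-words-3 (λ is → strictlyIncreasing is ∧ isOccurrence p1-3-2 π is) n ⟩
  _
    ≡⟨ Σ<-cong n (λ i → Σ<-cong n (λ j → Σ<-cong n (λ l → cong indicator (pointwise i j l)))) ⟩
  _
    ≡⟨ Σ<-count132 π ⟩
  count132 π ∎
  where
  open ≡-Reasoning
  n = length π
  ∧-shuffle : ∀ a b c → (a ∧ (b ∧ true)) ∧ c ≡ b ∧ (a ∧ c)
  ∧-shuffle false false c = refl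
  ∧-shuffle false true  c = refl
  ∧-shuffle true  false c = refl
  ∧-shuffle true  true  c = refl
  pointwise : ∀ i j l →
    strictlyIncreasing (i ∷ j ∷ l ∷ []) ∧ isOccurrence p1-3-2 π (i ∷ j ∷ l ∷ []) ≡
    (j <ᵇ l) ∧ ((i <ᵇ j) ∧ ((nth π i <ᵇ nth π l) ∧ (nth π l <ᵇ nth π j)))
  pointwise i j l = trans (∧-shuffle (i <ᵇ j) (j <ᵇ l) _)
    (cong (λ b → (j <ᵇ l) ∧ ((i <ᵇ j) ∧ b)) (orderIso-132 π i j l))

-- Occurrences of 21-3-⋯-k

Increasing : List ℕ → Set
Increasing = AllPairs.AllPairs _<_

Increasing-∷ : ∀ {i j w} → i < j → Increasing (j ∷ w) → Increasing (i ∷ j ∷ w)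
Increasing-∷ i<j (j< ∷ inc) = (i<j ∷ All.map (<-trans i<j) j<) ∷ j< ∷ inc

strictlyIncreasing⁻ : ∀ w → strictlyIncreasing w ≡ true → Increasing w
strictlyIncreasing⁻ []          _  = []
strictlyIncreasing⁻ (i ∷ [])    _  = [] ∷ []
strictlyIncreasing⁻ (i ∷ j ∷ w) eq =
  let i<j , eq′ = ∧-true⁻ {i <ᵇ j} eq in Increasing-∷ (<ᵇ-true⁻ i<j) (strictlyIncreasing⁻ (j ∷ w) eq′)

strictlyIncreasing⁺ : ∀ {w} → Increasing w → strictlyIncreasing w ≡ true
strictlyIncreasing⁺ []                      = refl
strictlyIncreasing⁺ (_ ∷ [])                = refl
strictlyIncreasing⁺ ((i<j ∷ _) ∷ (j< ∷ inc)) = ∧-true (<ᵇ-true i<j) (strictlyIncreasing⁺ (j< ∷ inc))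

All-nth : ∀ {P : ℕ → Set} {w} → All P w → ∀ {a} → a < length w → P (nth w a)
All-nth (p ∷ ps) {zero}  _        = p
All-nth (p ∷ ps) {suc a} (s≤s a<) = All-nth ps a<

All-nth⁻ : ∀ {P : ℕ → Set} w → (∀ {a} → a < length w → P (nth w a)) → All P w
All-nth⁻ []      _ = []
All-nth⁻ (x ∷ w) p = p z<s ∷ All-nth⁻ w (p ∘ s≤s)

Increasing-nth : ∀ {w} → Increasing w → ∀ {a b} → a < b → b < length w → nth w a < nth w b
Increasing-nth (x< ∷ inc) {zero}  {suc b} _         (s≤s b<) = All-nth x< b<
Increasing-nth (x< ∷ inc) {suc a} {suc b} (s≤s a<b) (s≤s b<) = Increasing-nth inc a<b b<

Increasing-nth⁻ : ∀ w → (∀ {a b} → a < b → b < length w → nth w a < nth w b) → Increasing w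
Increasing-nth⁻ []      _ = []
Increasing-nth⁻ (x ∷ w) p = All-nth⁻ w (λ b< → p z<s (s≤s b<)) ∷ Increasing-nth⁻ w (λ a<b b< → p (s≤s a<b) (s≤s b<))

nth-map : ∀ (f : ℕ → ℕ) w {a} → a < length w → nth (map f w) a ≡ f (nth w a)
nth-map f (x ∷ w) {zero}  _        = refl
nth-map f (x ∷ w) {suc a} (s≤s a<) = nth-map f w a<

nth-applyUpTo : ∀ (f : ℕ → ℕ) {n a} → a < n → nth (applyUpTo f n) a ≡ f a
nth-applyUpTo f {suc n} {zero}  _        = refl
nth-applyUpTo f {suc n} {suc a} (s≤s a<) = nth-applyUpTo (f ∘ suc) a<

drop-nth : ∀ {j} π → j < length π → drop j π ≡ nth π j ∷ drop (suc j) π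
drop-nth {zero}  (x ∷ π) _        = refl
drop-nth {suc j} (x ∷ π) (s≤s j<) = drop-nth π j<

drop-∷⁻ : ∀ q π {x w} → x ∷ w ≡ drop q π → q < length π × x ≡ nth π q × w ≡ drop (suc q) π
drop-∷⁻ zero    (x ∷ π) refl = z<s , refl , refl
drop-∷⁻ (suc q) (y ∷ π) eq   = let q< , ex , ew = drop-∷⁻ q π eq in s≤s q< , ex , ew

Ascends-drop : ∀ {r b} q π → Ascends r b (drop q π) → Ascends r b π
Ascends-drop zero    π       p = p
Ascends-drop (suc q) []      p = p
Ascends-drop (suc q) (x ∷ π) p = skip (Ascends-drop q π p)

Ascends-drop-≤ : ∀ {r b q q′} π → q ≤ q′ → Ascends r b (drop q′ π) → Ascends r b (drop q π)
Ascends-drop-≤ {q′ = q′} π z≤n     p = Ascends-drop q′ π p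
Ascends-drop-≤ []      (s≤s q≤) p = p
Ascends-drop-≤ (x ∷ π) (s≤s q≤) p = Ascends-drop-≤ π q≤ p

Contains-drop : ∀ {r} q π → Contains r (drop q π) → Contains r π
Contains-drop zero    π       p = p
Contains-drop (suc q) (x ∷ π) p = there (Contains-drop q π p)

module _ (π : List ℕ) where

  -- Positions are tracked by suffixes: an index `j` becomes a `take` at the head of `drop j π`,
  -- which is reached from `drop (suc p) π` by skips because `p < j`.
  Ascends-indices : ∀ {b p} js → Increasing (b ∷ map (nth π) js) → Increasing (p ∷ js) → All (_< length π) js →
                    Ascends (length js) b (drop (suc p) π)
  Ascends-indices []       _                     _                  _          = stop
  Ascends-indices (j ∷ js) ((b< ∷ _) ∷ vals) ((p<j ∷ _) ∷ inc) (j<n ∷ js<n) =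
    Ascends-drop-≤ π p<j (subst (Ascends _ _) (sym (drop-nth π j<n)) (take b< (Ascends-indices js vals inc js<n)))

  -- The suffix is a variable with an equation so that the derivation can be matched on; `q` is the
  -- position of its head in `π`.
  Ascends-indices⁻ : ∀ {r b w} q → w ≡ drop q π → Ascends r b w →
                     ∃ λ js → length js ≡ r × Increasing (b ∷ map (nth π) js) × All (q ≤_) js × Increasing js ×
                              All (_< length π) js
  Ascends-indices⁻ q eq stop = [] , refl , ([] ∷ []) , [] , [] , []
  Ascends-indices⁻ q eq (skip p) with drop-∷⁻ q π eq
  ... | _ , _ , eq′ with Ascends-indices⁻ (suc q) eq′ p
  ...   | js , size , vals , q< , inc , js<n = js , size , vals , All.map <⇒≤ q< , inc , js<n
  Ascends-indices⁻ q eq (take b<x p) with drop-∷⁻ q π eq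
  ... | q<n , refl , eq′ with Ascends-indices⁻ (suc q) eq′ p
  ...   | js , size , (x< ∷ vals) , q< , inc , js<n =
    q ∷ js , cong suc size , ((b<x ∷ All.map (<-trans b<x) x<) ∷ x< ∷ vals) ,
    ≤-refl ∷ All.map <⇒≤ q< , q< ∷ inc , q<n ∷ js<n

  Contains-index⁻ : ∀ {r w} q → w ≡ drop q π → Contains r w →
                    ∃ λ i → suc i < length π × nth π (suc i) < nth π i × Ascends r (nth π i) (drop (2 + i) π)
  Contains-index⁻ q eq (here a<b p) with drop-∷⁻ q π eq
  ... | _ , refl , eq′ with drop-∷⁻ (suc q) π eq′
  ...   | 1+q<n , refl , refl = q , 1+q<n , a<b , p
  Contains-index⁻ q eq (there p) with drop-∷⁻ q π eq
  ... | _ , _ , eq′ = Contains-index⁻ (suc q) eq′ p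

  module _ (r : ℕ) where
    private
      n = length π
      σ = p21-3-k (2 + r)
      τ = letters σ

    length-τ : length τ ≡ 2 + r
    length-τ = cong (2 +_) (trans (length-map (_+ 3) (upTo r)) (length-upTo r))

    nth-τ : ∀ {a} → a < r → nth τ (2 + a) ≡ a + 3
    nth-τ {a} a<r = trans (cong (λ w → nth w a) (map-upTo (_+ 3) r)) (nth-applyUpTo (_+ 3) a<r)

    3+ : ∀ a {b} → b < 3 → b < a + 3
    3+ a b<3 = ≤-trans b<3 (m≤n+m 3 a)

    occurrence⇒Contains : ∀ is → is ∈ indexTuples (length τ) n → isOccurrence σ π is ≡ true → Contains r π
    occurrence⇒Contains is is∈ occ with filterB-⊆ strictlyIncreasing (words n (length τ)) is∈
    ... | is∈′ , incB with ∈-words⁻ {n} (length τ) is∈′ | ∧-true⁻ {checkAdj (adjacent σ) is} occ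
    occurrence⇒Contains (i ∷ j ∷ js) is∈ occ | is∈′ , incB | size , (i<n ∷ j<n ∷ js<n) | adj , iso
      -- Adjacency forces `j` to be `suc i`, so the two descent letters head the suffix `drop i π`.
      with strictlyIncreasing⁻ (i ∷ j ∷ js) incB | ≡ᵇ-true⁻ {j} (proj₁ (∧-true⁻ adj))
    ... | _ ∷ inc | refl = Contains-drop i π (subst (Contains r)
          (sym (trans (drop-nth π i<n) (cong (nth π i ∷_) (drop-nth π j<n))))
          (here descent (subst (λ k → Ascends k _ _) size′ (Ascends-indices js vals inc js<n))))
      where
      size′ : length js ≡ r
      size′ = suc-injective (suc-injective (trans size length-τ))
      o : ∀ a b → a < 2 + r → b < 2 + r →
          (nth τ a <ᵇ nth τ b) ≡ (nth π (nth (i ∷ j ∷ js) a) <ᵇ nth π (nth (i ∷ j ∷ js) b))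
      o a b a< b< = orderIso⁻ τ π (i ∷ j ∷ js) iso a b (subst (a <_) (sym length-τ) a<) (subst (b <_) (sym length-τ) b<)
      descent : nth π j < nth π i
      descent = <ᵇ-true⁻ (sym (o 1 0 (s≤s (s≤s z≤n)) (s≤s z≤n)))
      js-bound : ∀ {b} → b < length (map (nth π) js) → b < length js
      js-bound = subst (_ <_) (length-map (nth π) js)
      vals : Increasing (nth π i ∷ map (nth π) js)
      -- The chain starts at the letter 2 in position 0 and leaves out the letter 1 in position 1,
      -- hence the shift from index `suc b` of the chain to position `2 + b` of the pattern.
      vals = Increasing-nth⁻ _ λ
        { {zero} {suc b} _ (s≤s b<) → let b<js = js-bound b< ; b<r = subst (b <_) size′ b<js in
            subst (nth π i <_) (sym (nth-map (nth π) js b<js))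
              (<ᵇ-true⁻ (trans (sym (o 0 (2 + b) (s≤s z≤n) (s≤s (s≤s b<r))))
                (<ᵇ-true (subst (2 <_) (sym (nth-τ b<r)) (3+ b ≤-refl)))))
        ; {suc a} {suc b} (s≤s a<b) (s≤s b<) →
            let b<js = js-bound b< ; a<js = <-trans a<b b<js
                b<r = subst (b <_) size′ b<js ; a<r = subst (a <_) size′ a<js in
            subst₂ _<_ (sym (nth-map (nth π) js a<js)) (sym (nth-map (nth π) js b<js))
              (<ᵇ-true⁻ (trans (sym (o (2 + a) (2 + b) (s≤s (s≤s a<r)) (s≤s (s≤s b<r))))
                (<ᵇ-true (subst₂ _<_ (sym (nth-τ a<r)) (sym (nth-τ b<r)) (+-monoˡ-< 3 a<b)))))
        }

    checkAdj-false : ∀ k is → checkAdj (replicate k false) is ≡ true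
    checkAdj-false zero    is           = refl
    checkAdj-false (suc k) []           = refl
    checkAdj-false (suc k) (i ∷ [])     = refl
    checkAdj-false (suc k) (i ∷ j ∷ is) = checkAdj-false k (j ∷ is)

    Contains⇒occurrence : Contains r π → ∃ λ is → is ∈ indexTuples (length τ) n × isOccurrence σ π is ≡ true
    Contains⇒occurrence c with Contains-index⁻ 0 refl c
    ... | i , 1+i<n , descent , asc with Ascends-indices⁻ (2 + i) refl asc
    ...   | js , size , vals@(y<vals ∷ vals′) , js> , inc , js<n = is , is∈ , ∧-true adj (orderIso⁺ τ π is o)
      where
      is = i ∷ suc i ∷ js
      is∈ : is ∈ indexTuples (length τ) n
      is∈ = ∈-filterB strictlyIncreasing {words n (length τ)}
        (∈-words⁺ {n} {length τ} (trans (cong (2 +_) size) (sym length-τ)) (<-trans (n<1+n i) 1+i<n ∷ 1+i<n ∷ js<n))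
        (strictlyIncreasing⁺ {is} ((n<1+n i ∷ All.map <⇒≤ js>) ∷ js> ∷ inc))
      adj : checkAdj (adjacent σ) is ≡ true
      adj = ∧-true (≡ᵇ-true {i} refl) (checkAdj-false r (suc i ∷ js))
      bound : ∀ {a} → 2 + a < length τ → a < r
      bound {a} p = ≤-pred (≤-pred (subst (2 + a <_) length-τ p))
      val : ∀ {a} → a < r → nth (map (nth π) js) a ≡ nth π (nth js a)
      val {a} a<r = nth-map (nth π) js (subst (a <_) (sym size) a<r)
      y<z : ∀ {a} → a < r → nth π i < nth π (nth js a)
      y<z {a} a<r = subst (nth π i <_) (val a<r)
        (All-nth y<vals (subst (a <_) (sym (trans (length-map (nth π) js) size)) a<r))
      z<z : ∀ {a b} → a < b → b < r → nth π (nth js a) < nth π (nth js b)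
      z<z {a} {b} a<b b<r = subst₂ _<_ (val (<-trans a<b b<r)) (val b<r)
        (Increasing-nth vals′ a<b (subst (b <_) (sym (trans (length-map (nth π) js) size)) b<r))
      o : ∀ a b → a < length τ → b < length τ →
          (nth τ a <ᵇ nth τ b) ≡ (nth π (nth is a) <ᵇ nth π (nth is b))
      o 0 0 _ _ = sym (<ᵇ-false (≤-refl {nth π i}))
      o 0 1 _ _ = sym (<ᵇ-false (<⇒≤ descent))
      o 1 0 _ _ = sym (<ᵇ-true descent)
      o 1 1 _ _ = sym (<ᵇ-false (≤-refl {nth π (suc i)}))
      o 0 (suc (suc b)) _ b< rewrite nth-τ (bound b<) | <ᵇ-true (y<z (bound b<)) = <ᵇ-true (3+ b {2} ≤-refl)
      o 1 (suc (suc b)) _ b< rewrite nth-τ (bound b<) | <ᵇ-true (<-trans descent (y<z (bound b<))) =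
        <ᵇ-true (3+ b {1} (s≤s (s≤s z≤n)))
      o (suc (suc a)) 0 a< _ rewrite nth-τ (bound a<) | <ᵇ-false (<⇒≤ (y<z (bound a<))) =
        <ᵇ-false (<⇒≤ (3+ a {2} ≤-refl))
      o (suc (suc a)) 1 a< _ rewrite nth-τ (bound a<) | <ᵇ-false (<⇒≤ (<-trans descent (y<z (bound a<)))) =
        <ᵇ-false (<⇒≤ (3+ a {1} (s≤s (s≤s z≤n))))
      o (suc (suc a)) (suc (suc b)) a< b< rewrite nth-τ (bound a<) | nth-τ (bound b<) with <-cmp a b
      ... | tri< a<b _ _  = trans (<ᵇ-true (+-monoˡ-< 3 a<b)) (sym (<ᵇ-true (z<z a<b (bound b<))))
      ... | tri≈ _ refl _ = trans (<ᵇ-false (≤-refl {a + 3})) (sym (<ᵇ-false (≤-refl {nth π (nth js a)})))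
      ... | tri> _ _ b<a  = trans (<ᵇ-false (+-monoˡ-≤ 3 (<⇒≤ b<a))) (sym (<ᵇ-false (<⇒≤ (z<z b<a (bound a<)))))

    avoids⁻ : avoids σ π ≡ true → ¬ Contains r π
    avoids⁻ eq c = let is , is∈ , occ = Contains⇒occurrence c in
      contradiction (trans (sym occ) (countB≡0⁻ {w = indexTuples (length τ) n} (≡ᵇ-true⁻ eq) is∈)) λ ()

    avoids⁺ : ¬ Contains r π → avoids σ π ≡ true
    avoids⁺ ¬c = ≡ᵇ-true (countB≡0 (indexTuples (length τ) n) λ {is} is∈ → not-occurrence is is∈)
      where
      not-occurrence : ∀ is → is ∈ indexTuples (length τ) n → isOccurrence σ π is ≡ false
      not-occurrence is is∈ with isOccurrence σ π is in occ
      ... | false = refl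
      ... | true  = ⊥-elim (¬c (occurrence⇒Contains is is∈ occ))

-- Generating functions and their closed forms

-- At `c = 1` this unfolds to `h (p21-3-k (2 + r)) n`, so the final identity applies to `H` without
-- conversion.
class# : ℕ → ℕ → ℕ → ℕ
class# r c n = countB (λ π → avoids (p21-3-k (2 + r)) π ∧ (occurrences p1-3-2 π ≡ᵇ c)) (perms n)

Enum-Class : ∀ r c n → Enum (Class r c n) (class# r c n)
Enum-Class r c n = enum (filterB p (perms n)) (Unique-filterB p (Unique-filterB distinct (Unique-words n n)))
  (length-filterB p (perms n)) sound complete
  where
  p : List ℕ → Bool
  p π = avoids (p21-3-k (2 + r)) π ∧ (occurrences p1-3-2 π ≡ᵇ c)
  sound : ∀ {w} → w ∈ filterB p (perms n) → Class r c n w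
  sound {w} w∈ with filterB-⊆ p (perms n) w∈
  ... | w∈′ , pw with ∧-true⁻ {avoids (p21-3-k (2 + r)) w} pw
  ...   | av , oc = class (∈-perms⁻ w∈′) (avoids⁻ w r av) (trans (sym (occurrences-132 w)) (≡ᵇ-true⁻ oc))
  complete : ∀ {w} → Class r c n w → w ∈ filterB p (perms n)
  complete {w} (class pw ¬c cnt) = ∈-filterB p (∈-perms⁺ pw)
    (∧-true (avoids⁺ w r ¬c) (≡ᵇ-true (trans (occurrences-132 w) cnt)))

open PowerSeries
open import Data.Integer as ℤ using (+_)
import Data.Integer.Properties as ℤ
import Relation.Binary.Reasoning.Setoid as SetoidReasoning

Σ<-+ : ∀ N (f g : ℕ → ℕ) → Σ< N (λ i → f i + g i) ≡ Σ< N f + Σ< N g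
Σ<-+ zero    f g = refl
Σ<-+ (suc N) f g rewrite Σ<-+ N (f ∘ suc) (g ∘ suc) = interchange (f 0) (g 0) _ _

-- Compares convolution with F with convolution with F - 1: the latter lacks the term with `f 0`.
-- The indexing `m ∸ 1 ∸ i` is the one that `containing-suc` yields at `suc m`.
Σ<-last : ∀ (g f : ℕ → ℕ) m →
  Σ< (suc m) (λ i → g i * f (m ∸ i)) ≡ Σ< m (λ i → g i * f (suc (m ∸ 1 ∸ i))) + g m * f 0
Σ<-last g f zero    = +-comm (g 0 * f 0) 0
Σ<-last g f (suc m) = trans
  (cong (λ z → g 0 * f (suc m) + z) (trans (Σ<-last (g ∘ suc) f m)
    (cong (_+ g (suc m) * f 0) (Σ<-cong m λ i → cong (λ k → g (suc i) * f (suc k)) (∸-+-assoc m 1 i)))))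
  (sym (+-assoc (g 0 * f (suc m)) _ _))

series : (ℕ → ℕ) → FPS
series f n = + f n

⊛-series : ∀ f g n → (series f ⊛ series g) n ≡ + Σ< (suc n) (λ i → f i * g (n ∸ i))
⊛-series f g n = trans (cong (foldr ℤ._+_ (+ 0)) (map-cong (λ i → sym (ℤ.pos-* (f i) (g (n ∸ i)))) (upTo (suc n))))
                       (foldr-pos (λ i → f i * g (n ∸ i)) (suc n))
  where
  foldr-pos : ∀ u N → foldr ℤ._+_ (+ 0) (map (λ i → + u i) (upTo N)) ≡ + Σ< N u
  foldr-pos u zero    = refl
  foldr-pos u (suc N) = trans (cong (foldr ℤ._+_ (+ 0)) (map-upTo-suc (λ i → + u i) N))
                              (cong (λ z → + u 0 ℤ.+ z) (foldr-pos (u ∘ suc) N))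

open Recurrences class# Enum-Class

avoiders containers leftFactors : ℕ → FPS
avoiders r    = series (class# r 0)
containers r  = series (class# r 1)
leftFactors r = series (leftOfCross# r)

avoiders-recurrence : ∀ r → avoiders (suc r) ≐ one ⊕ (X ⊛ (avoiders r ⊛ avoiders (suc r)))
avoiders-recurrence r zero    = cong +_ (Class-0-0 (suc r))
avoiders-recurrence r (suc n) = begin
  + class# (suc r) 0 (suc n)                              ≡⟨ cong +_ (avoiding-suc r n) ⟩
  + Σ< (suc n) (λ i → class# r 0 i * class# (suc r) 0 (n ∸ i)) ≡⟨ ⊛-series (class# r 0) (class# (suc r) 0) n ⟨
  (avoiders r ⊛ avoiders (suc r)) n                       ≡⟨ X⊛ (avoiders r ⊛ avoiders (suc r)) (suc n) ⟨
  (X ⊛ (avoiders r ⊛ avoiders (suc r))) (suc n)           ≡⟨ ℤ.+-identityˡ _ ⟨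
  (one ⊕ (X ⊛ (avoiders r ⊛ avoiders (suc r)))) (suc n)   ∎
  where open ≡-Reasoning

-- The summand x² G (F - 1) is split, and its negative part is added on the left. For the
-- coefficients 0 and 1 the x² terms vanish; from 2 on, `Σ<-last` completes the convolution.
containers-recurrence : ∀ r →
  containers (suc r) ⊕ (X ⊛ (X ⊛ leftFactors r)) ≐
  (X ⊛ ((containers r ⊛ avoiders (suc r)) ⊕ (avoiders r ⊛ containers (suc r))))
    ⊕ (X ⊛ (X ⊛ (leftFactors r ⊛ avoiders (suc r))))
containers-recurrence r = λ
  { n@zero → cong₂ ℤ._+_ (trans (cong +_ (Class-1-0 (suc r))) (sym (X⊛ P n))) (trans (X⊛ (X ⊛ L) n) (sym (X⊛ (X ⊛ (L ⊛ F)) n)))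
  ; n@(suc zero) → cong₂ ℤ._+_
      (trans (trans (cong +_ (trans (containing-suc r 0) (+-identityʳ _))) (sym (P-coefficient 0))) (sym (X⊛ P n)))
      (trans (trans (X⊛ (X ⊛ L) n) (X⊛ L 0)) (sym (trans (X⊛ (X ⊛ (L ⊛ F)) n) (X⊛ (L ⊛ F) 0))))
  ; (suc (suc m)) → begin
      + h₁ (2 + m) ℤ.+ (X ⊛ (X ⊛ L)) (2 + m)
        ≡⟨ cong (λ z → + h₁ (2 + m) ℤ.+ z) (XX L m) ⟩
      + (h₁ (2 + m) + l m)
        ≡⟨ cong +_ (step m) ⟩
      + p (suc m) ℤ.+ + Σ< (suc m) (λ i → l i * f (m ∸ i))
        ≡⟨ cong₂ ℤ._+_ (P-coefficient (suc m)) (⊛-series l f m) ⟨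
      P (suc m) ℤ.+ (L ⊛ F) m
        ≡⟨ cong₂ ℤ._+_ (X⊛ P (2 + m)) (XX (L ⊛ F) m) ⟨
      (X ⊛ P) (2 + m) ℤ.+ (X ⊛ (X ⊛ (L ⊛ F))) (2 + m) ∎
  }
  where
  open ≡-Reasoning
  F = avoiders (suc r)
  L = leftFactors r
  P = (containers r ⊛ F) ⊕ (avoiders r ⊛ containers (suc r))
  f = class# (suc r) 0
  h₁ = class# (suc r) 1
  l = leftOfCross# r
  p : ℕ → ℕ
  p n = Σ< (suc n) (λ i → class# r 1 i * f (n ∸ i) + class# r 0 i * h₁ (n ∸ i))
  XX : ∀ g m → (X ⊛ (X ⊛ g)) (2 + m) ≡ g m
  XX g m = trans (X⊛ (X ⊛ g) (2 + m)) (X⊛ g (suc m))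
  P-coefficient : ∀ n → P n ≡ + p n
  P-coefficient n = trans (cong₂ ℤ._+_ (⊛-series (class# r 1) f n) (⊛-series (class# r 0) h₁ n))
    (cong +_ (sym (Σ<-+ (suc n) (λ i → class# r 1 i * f (n ∸ i)) (λ i → class# r 0 i * h₁ (n ∸ i)))))
  step : ∀ m → h₁ (2 + m) + l m ≡ p (suc m) + Σ< (suc m) (λ i → l i * f (m ∸ i))
  step m = begin
    h₁ (2 + m) + l m
      ≡⟨ cong (_+ l m) (containing-suc r (suc m)) ⟩
    p (suc m) + Σ< m (λ i → l i * f (suc (m ∸ 1 ∸ i))) + l m
      ≡⟨ +-assoc (p (suc m)) _ (l m) ⟩
    p (suc m) + (Σ< m (λ i → l i * f (suc (m ∸ 1 ∸ i))) + l m)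
      ≡⟨ cong (λ z → p (suc m) + (Σ< m (λ i → l i * f (suc (m ∸ 1 ∸ i))) + z))
           (trans (sym (*-identityʳ (l m))) (cong (l m *_) (sym (Class-0-0 (suc r))))) ⟩
    p (suc m) + (Σ< m (λ i → l i * f (suc (m ∸ 1 ∸ i))) + l m * f 0)
      ≡⟨ cong (λ z → p (suc m) + z) (Σ<-last l f m) ⟨
    p (suc m) + Σ< (suc m) (λ i → l i * f (m ∸ i)) ∎

avoiders⊛R : ∀ r → avoiders r ⊛ R (2 + r) ≐ R (1 + r)
-- For `r = 0` the equation F_2 = 1 + x F_2 is read as the general recurrence with preceding factor
-- `one`, whose ratio is that of R_0 to R_1.
avoiders⊛R zero    = avoider-ratio FPS-commutativeRing {X} {avoiders 0} {one} {R 0} {R 1} {R 2}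
  (R-recurrence 0) increasing-recurrence (one-⊛ one)
  where
  increasing-recurrence : avoiders 0 ≐ one ⊕ (X ⊛ (one ⊛ avoiders 0))
  increasing-recurrence zero    = cong +_ (increasing-0 0)
  increasing-recurrence (suc n) = begin
    + class# 0 0 (suc n)                        ≡⟨ cong +_ (increasing-suc 0 n) ⟩
    + class# 0 0 n                              ≡⟨ one-⊛ (avoiders 0) n ⟨
    (one ⊛ avoiders 0) n                        ≡⟨ X⊛ (one ⊛ avoiders 0) (suc n) ⟨
    (X ⊛ (one ⊛ avoiders 0)) (suc n)            ≡⟨ ℤ.+-identityˡ _ ⟨
    (one ⊕ (X ⊛ (one ⊛ avoiders 0))) (suc n)    ∎
    where open ≡-Reasoning
avoiders⊛R (suc r) =
  avoider-ratio FPS-commutativeRing {X} {avoiders (suc r)} {avoiders r} {R (1 + r)} {R (2 + r)} {R (3 + r)}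
    (R-recurrence (suc r)) (avoiders-recurrence r) (avoiders⊛R r)

containers⊛R² : ∀ r → containers (suc r) ⊛ (R (3 + r) ⊛ R (3 + r)) ≐ rhsNumerator (3 + r)
containers⊛R² zero = begin
  containers 1 ⊛ (R 3 ⊛ R 3)
    -- Here `leftFactors 0` is the series 1, so `E` is `R 2` and not `R 1`.
    ≈⟨ container-ratio FPS-commutativeRing {X} {avoiders 1} {avoiders 0} {leftFactors 0} {containers 1} {containers 0}
         {R 1} {R 2} {R 3} {R 2} (R-recurrence 1) (avoiders⊛R 0) (avoiders⊛R 1)
         leftFactors⊛R (containers-recurrence 0) ⟩
  (X ⊛ (containers 0 ⊛ (R 2 ⊛ R 2))) ⊕ cube (R 2 ⊛ R 1)
    ≈⟨ 𝔽.+-congʳ (𝔽.trans (𝔽.*-congˡ {X} (𝔽.trans (⊛-cong {containers 0} {zeroS} {R 2 ⊛ R 2} {R 2 ⊛ R 2} no-containers (λ _ → refl)) (zeroS-⊛ (R 2 ⊛ R 2))))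
         (𝔽.zeroʳ X)) ⟩
  zeroS ⊕ cube (R 2 ⊛ R 1)
    ≈⟨ 𝔽.+-identityˡ (cube (R 2 ⊛ R 1)) ⟩
  cube (R 2 ⊛ R 1)
    ≈⟨ rhsNumerator-3 ⟨
  rhsNumerator 3 ∎
  where
  open SetoidReasoning FPS-setoid
  no-containers : containers 0 ≐ zeroS
  no-containers n = cong +_ (increasing-1 n)
  leftFactors⊛R : leftFactors 0 ⊛ R 2 ≐ R 2
  leftFactors⊛R = 𝔽.trans (⊛-cong {leftFactors 0} {one} {R 2} {R 2} (λ { zero → refl ; (suc n) → refl }) (λ _ → refl)) (one-⊛ (R 2))
containers⊛R² (suc r) = begin
  containers (2 + r) ⊛ (R (4 + r) ⊛ R (4 + r))
    -- From here on `leftFactors (suc r)` unfolds to `avoiders (suc r)`, so one ratio serves for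
    -- both F′ and G, and `E` is `R (2 + r)`.
    ≈⟨ container-ratio FPS-commutativeRing {X} {avoiders (2 + r)} {avoiders (suc r)} {leftFactors (suc r)}
         {containers (2 + r)} {containers (suc r)} {R (2 + r)} {R (3 + r)} {R (4 + r)} {R (2 + r)} (R-recurrence (2 + r)) (avoiders⊛R (suc r)) (avoiders⊛R (2 + r))
         (avoiders⊛R (suc r)) (containers-recurrence (suc r)) ⟩
  (X ⊛ (containers (suc r) ⊛ (R (3 + r) ⊛ R (3 + r)))) ⊕ cube (R (2 + r) ⊛ R (2 + r))
    ≈⟨ 𝔽.+-congʳ (𝔽.*-congˡ {X} (containers⊛R² r)) ⟩
  (X ⊛ rhsNumerator (3 + r)) ⊕ cube (R (2 + r) ⊛ R (2 + r))
    ≈⟨ rhsNumerator-suc (suc r) ⟨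
  rhsNumerator (4 + r) ∎
  where open SetoidReasoning FPS-setoid

theorem4p3 : (k : ℕ) → 3 ≤ k → (n : ℕ) →
    (H (p21-3-k k) ⊛ (R k ⊛ R k)) n ≡ rhsNumerator k n
theorem4p3 (suc (suc (suc r))) _ = containers⊛R² r
theorem4p3 (suc zero)       (s≤s ())
theorem4p3 (suc (suc zero)) (s≤s (s≤s ()))
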